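{- Let $N\ge2$ be an integer, $x\in[0,1]\setminus\mathbb{Q}$, and let $\widehat\omega=\widehat\omega(x,N)$ with factor complexity function $p_{\widehat\omega}$. Then for every $n\ge1$, $$p_{\widehat\omega}(n+1)-p_{\widehat\omega}(n)=\begin{cases}1,&\widehat t_{k-1}<n\le\widehat s_k\text{ for some }k\geq 1,\\2,&\widehat s_k<n\le\widehat t_k\text{ for some }k\geq 1.\end{cases}$$
   Context: Let $N\ge 1$ be an integer and define $T_N:[0,1]\to[0,1]$ by $T_N(x)=\frac{N}{x}-\lfloor\frac{N}{x}\rfloor$ for $x\ne0$ and $T_N(0)=0$. For $x\in[0,1]\setminus\mathbb{Q}$ the (greedy) NCF digits of $x$ are $d_n=\lfloor N/T_N^{n-1}(x)\rfloor\ge N$, $n\ge1$; one writes $x=[0;d_1,d_2,\ldots]_N$. Let $\widehat\sigma_n(0)=0^{d_n}1$, $\widehat\sigma_n(1)=0^N$ for $n\ge1$, extended to finite and infinite words over $\{0,1\}$ by concatenation. The dual NCF sequence $\widehat\omega(x,N)$ is the unique $\widehat\omega\in\{0,1\}^{\mathbb{N}}$ for which there exist $\widehat\omega^{(1)},\widehat\omega^{(2)},\ldots\in\{0,1\}^{\mathbb{N}}$ with $\widehat\omega^{(1)}=\widehat\omega$ and $\widehat\omega^{(n)}=\widehat\sigma_n(\widehat\omega^{(n+1)})$ for all $n\ge1$. The factor complexity $p_\nu(n)$ of a sequence $\nu$ is the number of distinct factors (contiguous subwords) of $\nu$ of length $n$. Put $\widehat\Sigma_1=0$, $\widehat\Sigma_{n+1}=\widehat\sigma_1\circ\cdots\circ\widehat\sigma_n(0)$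 for $n\ge1$. For $k\ge1$ let $\widehat S_k=\widehat\Sigma_k^{d_k}\widehat\Sigma_{k-1}^{d_{k-1}}\cdots\widehat\Sigma_1^{d_1}$ and $\widehat T_k=\widehat\Sigma_k^{N-1}\widehat S_k$. With $|\cdot|$ denoting word length, $\widehat s_k=|\widehat S_k|$, $\widehat t_k=|\widehat T_k|$ for $k\ge1$, and $\widehat t_0=0$, so that $\widehat t_0<\widehat s_1<\widehat t_1<\widehat s_2<\cdots$. -}

module Defs where

open import Data.Empty using (⊥-elim)
open import Data.Fin.Base using (Fin; toℕ)
open import Data.Fin.Patterns using (0F; 1F)
import Data.Integer.Base as ℤ
import Data.Integer.Properties as ℤ
open import Data.List.Base
  using (List; []; _∷_; _++_; [_]; length; concat; concatMap; replicate; applyUpTo)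
open import Data.List.Membership.Propositional using (_∈_)
open import Data.List.Relation.Unary.Unique.Propositional using (Unique)
open import Data.Nat.Base as ℕ using (ℕ; zero; suc; _∸_)
import Data.Nat.Properties as ℕ
open import Data.Product.Base using (Σ-syntax; ∃; ∃-syntax; _×_; _,_; proj₁; proj₂)
open import Data.Rational.Base
  using (ℚ; mkℚ; 0ℚ; 1ℚ; _/_; _+_; _*_; -_; _-_; 1/_; _<_; _≤_; *<*; toℚᵘ; positive)
open import Data.Rational.Properties
import Data.Rational.Unnormalised.Base as ℚᵘ
import Data.Rational.Unnormalised.Properties as ℚᵘ
open import Data.Sum.Base as Sum using (_⊎_; inj₁; inj₂)
open import Data.Vec.Base using (Vec; tabulate)
open import Function.Bundles using (_⇔_; mk⇔; Equivalence)
open import Relation.Binary.Definitions using (tri<; tri≈; tri>)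
open import Relation.Binary.PropositionalEquality
  using (_≡_; refl; sym; trans; cong; subst; subst₂)
open import Relation.Nullary using (¬_; yes; no)

------------------------------------------------------------------------
-- Rational arithmetic

fromℕ : ℕ → ℚ
fromℕ n = ℤ.+ n / 1

fromℕ-suc : ∀ n → fromℕ (suc n) ≡ 1ℚ + fromℕ n
fromℕ-suc n = toℚᵘ-injective (begin-equality
  toℚᵘ (fromℕ (suc n))             ≃⟨ toℚᵘ-fromℚᵘ (ℤ.+ suc n ℚᵘ./ 1) ⟩
  ℤ.+ suc n ℚᵘ./ 1                 ≃⟨ ℚᵘ.*≡* (cong (ℤ._* ℤ.1ℤ)
                                        (cong (ℤ._+_ ℤ.1ℤ) (sym (ℤ.*-identityʳ (ℤ.+ n))))) ⟩
  toℚᵘ 1ℚ ℚᵘ.+ (ℤ.+ n ℚᵘ./ 1)      ≃⟨ ℚᵘ.+-congʳ (toℚᵘ 1ℚ)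
                                        (toℚᵘ-fromℚᵘ (ℤ.+ n ℚᵘ./ 1)) ⟨
  toℚᵘ 1ℚ ℚᵘ.+ toℚᵘ (fromℕ n)      ≃⟨ toℚᵘ-homo-+ 1ℚ (fromℕ n) ⟨
  toℚᵘ (1ℚ + fromℕ n)              ∎)
  where open ℚᵘ.≤-Reasoning

fromℕ-pos : ∀ n .{{_ : ℕ.NonZero n}} → 0ℚ < fromℕ n
fromℕ-pos n@(suc _) = positive⁻¹ (fromℕ n) {{normalize-pos n 1}}

archimedean : ∀ q → ∃[ n ] q < fromℕ n
archimedean q@(mkℚ (ℤ.+ n) k _) = suc n , toℚᵘ-cancel-< (begin-strict
  toℚᵘ q                <⟨ ℚᵘ.*<* (subst (ℤ._< ℤ.+ suc n ℤ.* ℤ.+ suc k)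
                             (sym (ℤ.*-identityʳ (ℤ.+ n)))
                             (ℤ.+<+ (ℕ.m≤m*n (suc n) (suc k)))) ⟩
  ℤ.+ suc n ℚᵘ./ 1      ≃⟨ toℚᵘ-fromℚᵘ (ℤ.+ suc n ℚᵘ./ 1) ⟨
  toℚᵘ (fromℕ (suc n))  ∎)
  where open ℚᵘ.≤-Reasoning
archimedean (mkℚ ℤ.-[1+ n ] k _) = 0 , *<* ℤ.-<+

<⇒quotient : ∀ c {r} → 0ℚ < r → ∃[ s ] s * r ≡ c
<⇒quotient c {r} 0<r = c * 1/ r , trans (*-assoc c (1/ r) r)
  (trans (cong (c *_) (*-inverseˡ r)) (*-identityʳ c))
  where instance r≢0 = pos⇒nonZero r {{positive 0<r}}

*-monoˡ-<′ : ∀ {p q r} → 0ℚ < r → p < q → p * r < q * r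
*-monoˡ-<′ {r = r} 0<r = *-monoˡ-<-pos r {{positive 0<r}}

*-monoʳ-<′ : ∀ {p q r} → 0ℚ < r → p < q → r * p < r * q
*-monoʳ-<′ {r = r} 0<r = *-monoʳ-<-pos r {{positive 0<r}}

*-cancelʳ-<′ : ∀ p q {r} → 0ℚ < r → p * r < q * r → p < q
*-cancelʳ-<′ p q {r} 0<r = *-cancelʳ-<-nonNeg r {{pos⇒nonNeg r {{positive 0<r}}}} {p} {q}

*-cancelˡ-<′ : ∀ p q {r} → 0ℚ < r → r * p < r * q → p < q
*-cancelˡ-<′ p q {r} 0<r = *-cancelˡ-<-nonNeg r {{pos⇒nonNeg r {{positive 0<r}}}} {p} {q}

pos-factor : ∀ q {r} → 0ℚ < r → 0ℚ < q * r → 0ℚ < q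
pos-factor q {r} 0<r 0<qr = *-cancelʳ-<′ 0ℚ q 0<r (subst (_< q * r) (sym (*-zeroˡ r)) 0<qr)

sub-add : ∀ p q → (p - q) + q ≡ p
sub-add p q = trans (+-assoc p (- q) q)
  (trans (cong (p +_) (+-inverseˡ q)) (+-identityʳ p))

shift-< : ∀ {p q} r → p + r < q → p < q - r
shift-< {p} {q} r p+r<q = subst (_< q - r)
  (trans (+-assoc p r (- r)) (trans (cong (p +_) (+-inverseʳ r)) (+-identityʳ p)))
  (+-monoˡ-< (- r) p+r<q)

shift-> : ∀ {p q} r → q < p + r → q - r < p
shift-> {p} {q} r q<p+r = subst (q - r <_)
  (trans (+-assoc p r (- r)) (trans (cong (p +_) (+-inverseʳ r)) (+-identityʳ p)))
  (+-monoˡ-< (- r) q<p+r)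

------------------------------------------------------------------------
-- Dedekind reals: Lower q means q < x, and Upper q means x < q.

record ℝ : Set₁ where
  field
    Lower Upper   : ℚ → Set
    lower-inhab   : ∃ Lower
    upper-inhab   : ∃ Upper
    lower-rounded : ∀ q → Lower q ⇔ (∃[ r ] q < r × Lower r)
    upper-rounded : ∀ q → Upper q ⇔ (∃[ r ] r < q × Upper r)
    disjoint      : ∀ q → ¬ (Lower q × Upper q)
    located       : ∀ {q r} → q < r → Lower q ⊎ Upper r

  lower-open : ∀ {q} → Lower q → ∃[ r ] q < r × Lower r
  lower-open {q} = Equivalence.to (lower-rounded q)

  upper-open : ∀ {q} → Upper q → ∃[ r ] r < q × Upper r
  upper-open {q} = Equivalence.to (upper-rounded q)

  lower-closed : ∀ {q r} → q < r → Lower r → Lower q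
  lower-closed {q} q<r l = Equivalence.from (lower-rounded q) (_ , q<r , l)

  upper-closed : ∀ {q r} → r < q → Upper r → Upper q
  upper-closed {q} r<q u = Equivalence.from (upper-rounded q) (_ , r<q , u)

  lower<upper : ∀ {q r} → Lower q → Upper r → q < r
  lower<upper {q} {r} l u with <-cmp q r
  ... | tri< q<r _ _    = q<r
  ... | tri≈ _ refl _   = ⊥-elim (disjoint q (l , u))
  ... | tri> _ _ r<q    = ⊥-elim (disjoint q (l , upper-closed r<q u))

open ℝ

-- Irrationality in its positive (constructive) form: x is apart from
-- every rational.
Irrational : ℝ → Set
Irrational x = ∀ q → Lower x q ⊎ Upper x q

-- For x > 0, q < a/x iff q r < a for some rational r > x, and a/x < q iff
-- a < q r for some rational 0 < r < x.
module Division (a : ℚ) (0<a : 0ℚ < a) (x : ℝ) (0<x : Lower x 0ℚ) where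

  L U : ℚ → Set
  L q = ∃[ r ] Upper x r × q * r < a
  U q = ∃[ r ] 0ℚ < r × Lower x r × a < q * r

  nonpos⇒L : ∀ {q} → q ≤ 0ℚ → L q
  nonpos⇒L {q} q≤0 with upper-inhab x
  ... | r , u = r , u , ≤-<-trans
    (subst (q * r ≤_) (*-zeroˡ r)
      (*-monoʳ-≤-nonNeg r {{pos⇒nonNeg r {{positive (lower<upper x 0<x u)}}}} {q} {0ℚ} q≤0)) 0<a

  above⇒L : ∀ {q s} → 0ℚ < q → s * q ≡ a → Upper x s → L q
  above⇒L {q} {s} 0<q sq≡a u with upper-open x u
  ... | r , r<s , v = r , v ,
    subst₂ _<_ (*-comm r q) sq≡a (*-monoˡ-<′ 0<q r<s)

  below⇒U : ∀ {q s} → 0ℚ < q → s * q ≡ a → Lower x s → U q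
  below⇒U {q} {s} 0<q sq≡a l with lower-open x l
  ... | r , s<r , m = r , <-trans 0<s s<r , m ,
    subst₂ _<_ sq≡a (*-comm r q) (*-monoˡ-<′ 0<q s<r)
    where 0<s = pos-factor s 0<q (subst (0ℚ <_) (sym sq≡a) 0<a)

  L-open : ∀ {q} → L q → ∃[ q′ ] q < q′ × L q′
  L-open {q} (r , u , qr<a) =
    let 0<r = lower<upper x 0<x u
        m , qr<m , m<a = <-dense qr<a
        s , sr≡m = <⇒quotient m 0<r
    in s , *-cancelʳ-<′ q s 0<r (subst (q * r <_) (sym sr≡m) qr<m)
         , r , u , subst (_< a) (sym sr≡m) m<a

  U-open : ∀ {q} → U q → ∃[ q′ ] q′ < q × U q′
  U-open {q} (r , 0<r , l , a<qr) =
    let m , a<m , m<qr = <-dense a<qr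
        s , sr≡m = <⇒quotient m 0<r
    in s , *-cancelʳ-<′ s q 0<r (subst (_< q * r) (sym sr≡m) m<qr)
         , r , 0<r , l , subst (a <_) (sym sr≡m) a<m

  L∩U : ∀ q → ¬ (L q × U q)
  L∩U q ((r , u , qr<a) , (r′ , 0<r′ , l , a<qr′)) =
    <-asym (lower<upper x l u)
      (*-cancelˡ-<′ r r′ (pos-factor q 0<r′ (<-trans 0<a a<qr′)) (<-trans qr<a a<qr′))

  L∪U : ∀ {q q′} → q < q′ → L q ⊎ U q′
  L∪U {q} {q′} q<q′ with 0ℚ <? q
  ... | no  q≯0 = inj₁ (nonpos⇒L (≮⇒≥ q≯0))
  ... | yes 0<q =
    let 0<q′ = <-trans 0<q q<q′
        s  , sq≡a   = <⇒quotient a 0<q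
        s′ , s′q′≡a = <⇒quotient a 0<q′
        0<s  = pos-factor s 0<q (subst (0ℚ <_) (sym sq≡a) 0<a)
        s′<s = *-cancelʳ-<′ s′ s 0<q′
                 (subst (_< s * q′) (trans sq≡a (sym s′q′≡a)) (*-monoʳ-<′ 0<s q<q′))
    in Sum.swap (Sum.map (below⇒U 0<q′ s′q′≡a) (above⇒L 0<q sq≡a) (located x s′<s))

  quotient : ℝ
  quotient = record
    { Lower         = L
    ; Upper         = U
    ; lower-inhab   = 0ℚ , nonpos⇒L ≤-refl
    ; upper-inhab   = let r , 0<r , l = lower-open x 0<x
                          m , a<m     = archimedean a
                          s , sr≡m    = <⇒quotient (fromℕ m) 0<r
                      in s , r , 0<r , l , subst (a <_) (sym sr≡m) a<m
    ; lower-rounded = λ q → mk⇔ L-open λ (_ , q<q′ , r , u , q′r<a) →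
                        r , u , <-trans (*-monoˡ-<′ (lower<upper x 0<x u) q<q′) q′r<a
    ; upper-rounded = λ q → mk⇔ U-open λ (_ , q′<q , r , 0<r , l , a<q′r) →
                        r , 0<r , l , <-trans a<q′r (*-monoˡ-<′ 0<r q′<q)
    ; disjoint      = L∩U
    ; located       = L∪U
    }

  quotient-irrational : Irrational x → Irrational quotient
  quotient-irrational irr q with 0ℚ <? q
  ... | no  q≯0 = inj₁ (nonpos⇒L (≮⇒≥ q≯0))
  ... | yes 0<q = let s , sq≡a = <⇒quotient a 0<q
                  in Sum.swap (Sum.map (below⇒U 0<q sq≡a) (above⇒L 0<q sq≡a) (irr s))

_-ℚ_ : ℝ → ℚ → ℝ
x -ℚ c = record
  { Lower         = λ q → Lower x (q + c)
  ; Upper         = λ q → Upper x (q + c)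
  ; lower-inhab   = let q , l = lower-inhab x
                    in q - c , subst (Lower x) (sym (sub-add q c)) l
  ; upper-inhab   = let q , u = upper-inhab x
                    in q - c , subst (Upper x) (sym (sub-add q c)) u
  ; lower-rounded = λ q → mk⇔
      (λ l → let r , q<r , m = lower-open x l
             in r - c , shift-< c q<r , subst (Lower x) (sym (sub-add r c)) m)
      (λ (r , q<r , m) → lower-closed x (+-monoˡ-< c q<r) m)
  ; upper-rounded = λ q → mk⇔
      (λ u → let r , r<q , v = upper-open x u
             in r - c , shift-> c r<q , subst (Upper x) (sym (sub-add r c)) v)
      (λ (r , r<q , v) → upper-closed x (+-monoˡ-< c r<q) v)
  ; disjoint      = λ q → disjoint x (q + c)
  ; located       = λ q<r → located x (+-monoˡ-< c q<r)
  }

IsFloor : ℝ → ℕ → Set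
IsFloor y d = ¬ Upper y (fromℕ d) × Upper y (fromℕ (suc d))

floor : ∀ y → ¬ Upper y 0ℚ → Irrational y → ∃ (IsFloor y)
floor y y≥0 irr = let r , u   = upper-inhab y
                      m , r<m = archimedean r
                  in search m (upper-closed y r<m u)
  where
  search : ∀ m → Upper y (fromℕ m) → ∃ (IsFloor y)
  search zero    u = ⊥-elim (y≥0 u)
  search (suc m) u with irr (fromℕ m)
  ... | inj₁ l = m , (λ v → disjoint y _ (l , v)) , u
  ... | inj₂ v = search m v

------------------------------------------------------------------------
-- N-continued fractions

-- The elements of [0,1] ∖ ℚ.
record UnitIrrational : Set₁ where
  field
    real       : ℝ
    0≤real     : ¬ Upper real 0ℚ
    real≤1     : ¬ Lower real 1ℚ
    irrational : Irrational real

  0<real : Lower real 0ℚ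
  0<real with irrational 0ℚ
  ... | inj₁ l = l
  ... | inj₂ u = ⊥-elim (0≤real u)

module NCF (N : ℕ) .{{_ : ℕ.NonZero N}} where

  module N/ (x : UnitIrrational) where
    open UnitIrrational x
    open Division (fromℕ N) (fromℕ-pos N) real 0<real public

  ⌊N/_⌋ : (x : UnitIrrational) → ∃ (IsFloor (N/.quotient x))
  ⌊N/ x ⌋ = floor (N/.quotient x)
    (λ u → N/.L∩U x 0ℚ (N/.nonpos⇒L x ≤-refl , u))
    (N/.quotient-irrational x (UnitIrrational.irrational x))

  -- The map T_N, which is only ever iterated on irrationals.
  T : UnitIrrational → UnitIrrational
  T x = record
    { real       = y -ℚ fromℕ d
    ; 0≤real     = λ u → proj₁ d-floor (subst (Upper y) (+-identityˡ (fromℕ d)) u)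
    ; real≤1     = λ l → disjoint y (1ℚ + fromℕ d)
                     (l , subst (Upper y) (fromℕ-suc d) (proj₂ d-floor))
    ; irrational = λ q → y-irrational (q + fromℕ d)
    }
    where
    y = N/.quotient x
    y-irrational = N/.quotient-irrational x (UnitIrrational.irrational x)
    d = proj₁ ⌊N/ x ⌋
    d-floor = proj₂ ⌊N/ x ⌋

  T^ : ℕ → UnitIrrational → UnitIrrational
  T^ zero    x = x
  T^ (suc n) x = T (T^ n x)

  -- digit x n is d_{n+1}.
  digit : UnitIrrational → ℕ → ℕ
  digit x n = proj₁ ⌊N/ T^ n x ⌋

------------------------------------------------------------------------
-- Words over {0,1}

Letter : Set
Letter = Fin 2

Word : Set
Word = List Letter

InfWord : Set
InfWord = ℕ → Letter

prefix : InfWord → ℕ → Word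
prefix = applyUpTo

_^ʷ_ : Word → ℕ → Word
w ^ʷ n = concat (replicate n w)

-- ν = h(μ) for a substitution h none of whose images is empty: every
-- h(prefix of μ) is a prefix of ν.
IsImage : (Letter → Word) → InfWord → InfWord → Set
IsImage h μ ν = ∀ m → let w = concatMap h (prefix μ m) in prefix ν (length w) ≡ w

factorAt : InfWord → ℕ → (n : ℕ) → Vec Letter n
factorAt ν i n = tabulate λ j → ν (i ℕ.+ toℕ j)

IsFactor : InfWord → ∀ {n} → Vec Letter n → Set
IsFactor ν {n} w = ∃[ i ] factorAt ν i n ≡ w

-- p n is the number of distinct factors of length n.
IsFactorComplexity : InfWord → (ℕ → ℕ) → Set
IsFactorComplexity ν p = ∀ n → Σ[ ws ∈ List (Vec Letter n) ]
  Unique ws × (∀ w → w ∈ ws ⇔ IsFactor ν w) × length ws ≡ p n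

------------------------------------------------------------------------
-- The dual sequence attached to N and digits d_1, d_2, …, where d n is
-- d_{n+1}.

module Dual (N : ℕ) (d : ℕ → ℕ) where

  -- σ̂ n is σ̂_{n+1}.
  σ̂ : ℕ → Letter → Word
  σ̂ n 0F = replicate (d n) 0F ++ [ 1F ]
  σ̂ n 1F = replicate N 0F

  -- ω^(n+1) is written ωs n.
  IsDualSequence : InfWord → Set
  IsDualSequence ω = Σ[ ωs ∈ (ℕ → InfWord) ]
    (∀ i → ωs 0 i ≡ ω i) × (∀ n → IsImage (σ̂ n) (ωs (suc n)) (ωs n))

  -- σ̂_1 ∘ ⋯ ∘ σ̂_n
  σ̂∘ : ℕ → Word → Word
  σ̂∘ zero    w = w
  σ̂∘ (suc n) w = σ̂∘ n (concatMap (σ̂ n) w)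

  -- Σ̂ n is Σ̂_{n+1}.
  Σ̂ : ℕ → Word
  Σ̂ n = σ̂∘ n [ 0F ]

  -- Ŝ k is Ŝ_k, with Ŝ 0 the empty product; ŝ and t̂ are likewise unshifted.
  Ŝ : ℕ → Word
  Ŝ zero    = []
  Ŝ (suc k) = Σ̂ k ^ʷ d k ++ Ŝ k

  ŝ : ℕ → ℕ
  ŝ k = length (Ŝ k)

  -- T̂₊ k is T̂_{k+1}.
  T̂₊ : ℕ → Word
  T̂₊ k = Σ̂ k ^ʷ (N ∸ 1) ++ Ŝ (suc k)

  t̂ : ℕ → ℕ
  t̂ zero    = 0
  t̂ (suc k) = length (T̂₊ k)

  -- With k ≥ 1 written as suc j: t̂_{k-1} < n ≤ ŝ_k, and ŝ_k < n ≤ t̂_k.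
  Case₁ Case₂ : ℕ → Set
  Case₁ n = ∃[ j ] t̂ j ℕ.< n × n ℕ.≤ ŝ (suc j)
  Case₂ n = ∃[ j ] ŝ (suc j) ℕ.< n × n ℕ.≤ t̂ (suc j)

{-# OPTIONS --safe #-}
-- p(n+1) − p(n) is the number of right special factors of length n. In ω̂ = σ̂₁(ω̂⁽²⁾) the runs of
-- zeros between two 1s have length d₁ or N + d₁, so a right special factor is either a run of at
-- most N − 1 + d₁ zeros or ends in 10^{d₁}, in which case it is a suffix of σ̂₁(v)0^{d₁} for a shorter
-- right special factor v of ω̂⁽²⁾. Since T̂_{k+1} = σ̂₁(T̂′_k)0^{d₁}, where T̂′ is built from d₂, d₃, …,
-- the right special factors are exactly the suffixes of the words T̂_k. These form a tree whose
-- infinite branch carries the words Ŝ_k, and T̂_k leaves it at length ŝ_k, because Σ̂_k and Σ̂_{k+1}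
-- end in different letters.
module Submission where

open import Defs
open import Data.Empty using (⊥; ⊥-elim)
open import Data.Fin.Base using (toℕ; opposite)
open import Data.Fin.Patterns using (0F; 1F)
open import Data.Fin.Properties using (_≟_)
open import Data.Integer.Base using (+_; _⊖_)
import Data.Integer.Properties as ℤ
open import Data.List.Base
  using (List; []; _∷_; [_]; _++_; _∷ʳ_; length; map; concatMap; replicate; applyUpTo)
open import Data.List.Membership.Propositional using (_∈_)
open import Data.List.Membership.Propositional.Properties
  using (∈-map⁺; ∈-map⁻; ∈-++⁺ˡ; ∈-++⁺ʳ; ∈-++⁻)
open import Data.List.Properties
open import Data.List.Relation.Unary.All using ([]; _∷_)
open import Data.List.Relation.Unary.AllPairs using ([]; _∷_)
open import Data.List.Relation.Unary.Any using (here; there)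
open import Data.List.Relation.Unary.Unique.Propositional using (Unique)
import Data.List.Relation.Unary.Unique.Propositional.Properties as Unique
open import Data.List.Reverse using (Reverse; []; _∶_∶ʳ_; reverseView)
open import Data.Nat.Base
open import Data.Nat.Properties hiding (_≟_)
open import Data.Product.Base using (∃-syntax; Σ-syntax; _×_; _,_; proj₁; proj₂)
import Data.Rational.Base as ℚ
import Data.Rational.Properties as ℚ
open import Data.Sum.Base using (_⊎_; inj₁; inj₂)
open import Data.Vec.Base as Vec using (Vec; tabulate; toList)
import Data.Vec.Properties as Vec
open import Function.Base using (_∘_)
open import Function.Bundles using (_⇔_; mk⇔; Equivalence)
open import Relation.Binary.PropositionalEquality
  using (_≡_; _≢_; _≗_; refl; sym; trans; cong; cong₂; subst; subst₂; module ≡-Reasoning)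
open import Relation.Nullary using (¬_; yes; no)

-- Words and suffixes

-- Levi's lemma; `r` is the piece of the common word between the two cuts.
levi : ∀ {A : Set} (p : List A) {u q v} → p ++ u ≡ q ++ v →
  (∃[ r ] p ≡ q ++ r × v ≡ r ++ u) ⊎ (∃[ r ] q ≡ p ++ r × u ≡ r ++ v)
levi []      {q = q}     eq = inj₂ (q , refl , eq)
levi (a ∷ p) {q = []}    eq = inj₁ (a ∷ p , refl , sym eq)
levi (a ∷ p) {q = b ∷ q} eq with ∷-injective eq
... | refl , eq′ with levi p eq′
...   | inj₁ (r , p≡ , v≡) = inj₁ (r , cong (a ∷_) p≡ , v≡)
...   | inj₂ (r , q≡ , u≡) = inj₂ (r , cong (a ∷_) q≡ , u≡)

IsSuffix : Word → Word → Set
IsSuffix u w = ∃[ p ] p ++ u ≡ w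

suffix-refl : ∀ {u} → IsSuffix u u
suffix-refl = [] , refl

suffix-++ˡ : ∀ p {u v} → IsSuffix u v → IsSuffix u (p ++ v)
suffix-++ˡ p {u} (q , refl) = p ++ q , ++-assoc p q u

suffix-++ʳ : ∀ {u v} z → IsSuffix u v → IsSuffix (u ++ z) (v ++ z)
suffix-++ʳ {u} z (p , refl) = p , sym (++-assoc p u z)

suffix-trans : ∀ {u v w} → IsSuffix u v → IsSuffix v w → IsSuffix u w
suffix-trans s (q , refl) = suffix-++ˡ q s

suffix-concatMap : ∀ f {u v} → IsSuffix u v → IsSuffix (concatMap f u) (concatMap f v)
suffix-concatMap f {u} (p , refl) = concatMap f p , sym (concatMap-++ f p u)

suffix-of-++ : ∀ {u} v {w} → IsSuffix u (v ++ w) →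
  IsSuffix u w ⊎ (∃[ u′ ] u ≡ u′ ++ w × IsSuffix u′ v)
suffix-of-++ v (p , eq) with levi p eq
... | inj₁ (r , _ , w≡)      = inj₁ (r , sym w≡)
... | inj₂ (r , v≡ , u≡)     = inj₂ (r , u≡ , p , sym v≡)

suffix-cancelʳ : ∀ {u v} z → IsSuffix (u ++ z) (v ++ z) → IsSuffix u v
suffix-cancelʳ {u} {v} z (p , eq) = p , ++-cancelʳ z (p ++ u) v (trans (++-assoc p u z) eq)

suffix-length : ∀ {u w} → IsSuffix u w → length u ≤ length w
suffix-length {u} (p , refl) = length-++-≤ʳ u {p}

suffix-same-length : ∀ {u w} → IsSuffix u w → length w ≤ length u → u ≡ w
suffix-same-length ([] , eq) _ = eq
suffix-same-length {u} (a ∷ p , refl) w≤u = ⊥-elim (<⇒≱ (s≤s (length-++-≤ʳ u {p})) w≤u)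

suffix-comparable : ∀ {u v w} → IsSuffix u w → IsSuffix v w → length u ≤ length v → IsSuffix u v
suffix-comparable {u} {v} (p , refl) (q , eq) u≤v with levi q eq
... | inj₁ (r , _ , u≡) =
  subst (λ z → IsSuffix z v) (suffix-same-length (r , sym u≡) u≤v) suffix-refl
... | inj₂ (r , _ , v≡) = r , sym v≡

ends-in-suffix : ∀ {u w : Word} {a b : Letter} → IsSuffix (u ∷ʳ a) (w ∷ʳ b) → a ≡ b
ends-in-suffix {u} {w} {a} (p , eq) =
  ∷ʳ-injectiveʳ (p ++ u) w (trans (++-assoc p u [ a ]) eq)

-- Factors of infinite words

infix 4 _⊑_

-- Occurrence as a list inside some prefix, which is compatible with concatenation and `concatMap`.
-- `IsFactor⇒⊑` and `⊑⇒IsFactor` connect it with the vectors of fixed length that are counted.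
_⊑_ : Word → InfWord → Set
u ⊑ ν = ∃[ m ] ∃[ α ] ∃[ β ] prefix ν m ≡ α ++ u ++ β

⊑-prefix : ∀ ν m → prefix ν m ⊑ ν
⊑-prefix ν m = m , [] , [] , sym (++-identityʳ _)

⊑-++ˡ : ∀ {ν} p {u} → p ++ u ⊑ ν → u ⊑ ν
⊑-++ˡ p {u} (m , α , β , eq) = m , α ++ p , β ,
  trans eq (trans (cong (α ++_) (++-assoc p u β)) (sym (++-assoc α p (u ++ β))))

⊑-++ʳ : ∀ {ν} u {q} → u ++ q ⊑ ν → u ⊑ ν
⊑-++ʳ u {q} (m , α , β , eq) = m , α , q ++ β , trans eq (cong (α ++_) (++-assoc u q β))

⊑-suffix : ∀ {ν u w} → IsSuffix u w → w ⊑ ν → u ⊑ ν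
⊑-suffix (p , refl) = ⊑-++ˡ p

⊑-extend : ∀ {ν u} → u ⊑ ν → ∃[ a ] u ∷ʳ a ⊑ ν
-- The occurrence reaches the end of the prefix, so the prefix has to grow by one letter.
⊑-extend {ν} {u} (m , α , [] , eq) = ν m , suc m , α , [] , (begin
  prefix ν (suc m)               ≡⟨ applyUpTo-∷ʳ ν m ⟨
  prefix ν m ∷ʳ ν m              ≡⟨ cong (_∷ʳ ν m) (trans eq (cong (α ++_) (++-identityʳ u))) ⟩
  (α ++ u) ∷ʳ ν m                ≡⟨ ++-assoc α u [ ν m ] ⟩
  α ++ (u ∷ʳ ν m)                ≡⟨ cong (α ++_) (++-identityʳ (u ∷ʳ ν m)) ⟨
  α ++ (u ∷ʳ ν m) ++ []          ∎)
  where open ≡-Reasoning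
⊑-extend {ν} {u} (m , α , b ∷ β , eq) = b , m , α , β ,
  trans eq (cong (α ++_) (sym (∷ʳ-++ u b β)))

applyUpTo-+ : ∀ {A : Set} (f : ℕ → A) m n →
  applyUpTo f (m + n) ≡ applyUpTo f m ++ applyUpTo (λ j → f (m + j)) n
applyUpTo-+ f zero    n = refl
applyUpTo-+ f (suc m) n = cong (f 0 ∷_) (applyUpTo-+ (f ∘ suc) m n)

toList-tabulate : ∀ {A : Set} (f : ℕ → A) n → toList (tabulate {n = n} (f ∘ toℕ)) ≡ applyUpTo f n
toList-tabulate f zero    = refl
toList-tabulate f (suc n) = cong (f 0 ∷_) (toList-tabulate (f ∘ suc) n)

toList-factorAt : ∀ ν i n → toList (factorAt ν i n) ≡ applyUpTo (λ j → ν (i + j)) n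
toList-factorAt ν i = toList-tabulate (λ j → ν (i + j))

applyUpTo-prefix : ∀ {A : Set} (f : ℕ → A) m u {β} → applyUpTo f m ≡ u ++ β →
  applyUpTo f (length u) ≡ u
applyUpTo-prefix f m       []      eq = refl
applyUpTo-prefix f zero    (a ∷ u) ()
applyUpTo-prefix f (suc m) (a ∷ u) eq with ∷-injective eq
... | refl , eq′ = cong (f 0 ∷_) (applyUpTo-prefix (f ∘ suc) m u eq′)

applyUpTo-factor : ∀ {A : Set} (f : ℕ → A) m α u {β} → applyUpTo f m ≡ α ++ u ++ β →
  applyUpTo (λ j → f (length α + j)) (length u) ≡ u
applyUpTo-factor f m       []      u eq = applyUpTo-prefix f m u eq
applyUpTo-factor f zero    (a ∷ α) u ()
applyUpTo-factor f (suc m) (a ∷ α) u eq = applyUpTo-factor (f ∘ suc) m α u (∷-injectiveʳ eq)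

toList-injective : ∀ {n} {v w : Vec Letter n} → toList v ≡ toList w → v ≡ w
toList-injective {v = v} {w} eq =
  trans (sym (Vec.cast-is-id refl v)) (Vec.toList-injective refl v w eq)

IsFactor⇒⊑ : ∀ {ν n} {w : Vec Letter n} → IsFactor ν w → toList w ⊑ ν
IsFactor⇒⊑ {ν} {n} (i , refl) = i + n , prefix ν i , [] , (begin
  prefix ν (i + n)                             ≡⟨ applyUpTo-+ ν i n ⟩
  prefix ν i ++ applyUpTo (λ j → ν (i + j)) n       ≡⟨ cong (prefix ν i ++_) (toList-factorAt ν i n) ⟨
  prefix ν i ++ toList (factorAt ν i n)        ≡⟨ cong (prefix ν i ++_) (++-identityʳ _) ⟨
  prefix ν i ++ toList (factorAt ν i n) ++ []  ∎)
  where open ≡-Reasoning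

⊑⇒IsFactor : ∀ {ν n} (w : Vec Letter n) → toList w ⊑ ν → IsFactor ν w
⊑⇒IsFactor {ν} {n} w (m , α , β , eq) = length α , toList-injective (begin
  toList (factorAt ν (length α) n)                    ≡⟨ toList-factorAt ν (length α) n ⟩
  applyUpTo (λ j → ν (length α + j)) n                     ≡⟨ cong (applyUpTo _) (Vec.length-toList w) ⟨
  applyUpTo (λ j → ν (length α + j)) (length (toList w))   ≡⟨ applyUpTo-factor ν m α (toList w) eq ⟩
  toList w                                            ∎)
  where open ≡-Reasoning

-- Right special factors

RightSpecial : InfWord → Word → Set
RightSpecial ν w = ∀ a → w ∷ʳ a ⊑ ν

RightSpecial-suffix : ∀ {ν u w} → IsSuffix u w → RightSpecial ν w → RightSpecial ν u
RightSpecial-suffix s rs a = ⊑-suffix (suffix-++ʳ [ a ] s) (rs a)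

ListsRightSpecial : ∀ ν {n} → List (Vec Letter n) → Set
ListsRightSpecial ν {n} R =
  Unique R × (∀ (w : Vec Letter n) → w ∈ R ⇔ RightSpecial ν (toList w))

ListsFactors : ∀ ν {n} → List (Vec Letter n) → Set
ListsFactors ν {n} ws = Unique ws × (∀ (w : Vec Letter n) → w ∈ ws ⇔ IsFactor ν w)

opposite-irrefl : ∀ (a : Letter) → a ≢ opposite a
opposite-irrefl 0F ()
opposite-irrefl 1F ()

≡-or-opposite : ∀ (a b : Letter) → b ≡ a ⊎ b ≡ opposite a
≡-or-opposite 0F 0F = inj₁ refl
≡-or-opposite 0F 1F = inj₂ refl
≡-or-opposite 1F 0F = inj₂ refl
≡-or-opposite 1F 1F = inj₁ refl

both-letters : ∀ {P : Letter → Set} a → P a → P (opposite a) → ∀ b → P b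
both-letters {P} a pa p-a b with ≡-or-opposite a b
... | inj₁ refl = pa
... | inj₂ refl = p-a

-- Every factor has a chosen right extension, and only the right special ones have another.
extend-factors : ∀ {ν n} (ws R : List (Vec Letter n)) → ListsFactors ν ws → ListsRightSpecial ν R →
  ∃[ ws′ ] ListsFactors ν {suc n} ws′ × length ws′ ≡ length ws + length R
extend-factors {ν} {n} ws R (ws! , ws⇔) (R! , R⇔) =
  map next ws ++ map other R ,
  (Unique.++⁺ (Unique.map⁺ (Vec.∷ʳ-injectiveˡ _ _) ws!)
              (Unique.map⁺ (Vec.∷ʳ-injectiveˡ _ _) R!)
              disjoint′ ,
   λ v → mk⇔ (sound v) (complete v)) ,
  trans (length-++ (map next ws)) (cong₂ _+_ (length-map next ws) (length-map other R))
  where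
  open import Data.List.Membership.DecPropositional (Vec.≡-dec {n = n} (_≟_ {2})) using (_∈?_)

  extension : ∀ w → w ∈ ws → ∃[ a ] toList w ∷ʳ a ⊑ ν
  extension w w∈ = ⊑-extend (IsFactor⇒⊑ (Equivalence.to (ws⇔ w) w∈))

  letter : Vec Letter n → Letter
  letter w with w ∈? ws
  ... | yes w∈ = proj₁ (extension w w∈)
  -- An arbitrary value outside `ws`. It is harmless: `letter-extends` speaks of members of `ws`
  -- only, and a word of `R` may be extended by either letter.
  ... | no  _  = 0F

  letter-extends : ∀ {w} → w ∈ ws → toList w ∷ʳ letter w ⊑ ν
  letter-extends {w} w∈ with w ∈? ws
  ... | yes w∈′ = proj₂ (extension w w∈′)
  ... | no  w∉  = ⊥-elim (w∉ w∈)

  next other : Vec Letter n → Vec Letter (suc n)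
  next  w = w Vec.∷ʳ letter w
  other w = w Vec.∷ʳ opposite (letter w)

  factor : ∀ w a → toList w ∷ʳ a ⊑ ν → IsFactor ν (w Vec.∷ʳ a)
  factor w a f = ⊑⇒IsFactor (w Vec.∷ʳ a) (subst (_⊑ ν) (sym (Vec.toList-∷ʳ a w)) f)

  disjoint′ : ∀ {v} → ¬ (v ∈ map next ws × v ∈ map other R)
  disjoint′ (v∈ , v∈′) with ∈-map⁻ next v∈ | ∈-map⁻ other v∈′
  ... | w , _ , refl | r , _ , eq with Vec.∷ʳ-injective w r eq
  ...   | refl , a≡ = opposite-irrefl (letter w) a≡

  sound : ∀ v → v ∈ map next ws ++ map other R → IsFactor ν v
  sound v v∈ with ∈-++⁻ (map next ws) v∈
  ... | inj₁ v∈ˡ with w , w∈ , refl ← ∈-map⁻ next v∈ˡ = factor w _ (letter-extends w∈)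
  ... | inj₂ v∈ʳ with r , r∈ , refl ← ∈-map⁻ other v∈ʳ =
    factor r _ (Equivalence.to (R⇔ r) r∈ _)

  complete : ∀ v → IsFactor ν v → v ∈ map next ws ++ map other R
  complete v f with Vec.initLast v
  ... | w , b , refl = by-letter (≡-or-opposite (letter w) b)
    where
    wb⊑ν : toList w ∷ʳ b ⊑ ν
    wb⊑ν = subst (_⊑ ν) (Vec.toList-∷ʳ b w) (IsFactor⇒⊑ f)

    w∈ : w ∈ ws
    w∈ = Equivalence.from (ws⇔ w) (⊑⇒IsFactor w (⊑-++ʳ (toList w) wb⊑ν))

    by-letter : b ≡ letter w ⊎ b ≡ opposite (letter w) →
      w Vec.∷ʳ b ∈ map next ws ++ map other R
    by-letter (inj₁ refl) = ∈-++⁺ˡ (∈-map⁺ next w∈)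
    by-letter (inj₂ refl) = ∈-++⁺ʳ (map next ws) (∈-map⁺ other
      (Equivalence.from (R⇔ w) (both-letters (letter w) (letter-extends w∈) wb⊑ν)))

-- The recurrence serves as the definition of `p`, starting from the single empty factor. It
-- therefore holds by `refl`, and induction through `extend-factors` shows that `p` counts factors.
complexity-from-right-special : ∀ ν (R : ∀ n → List (Vec Letter n)) →
  (∀ n → ListsRightSpecial ν (R n)) →
  ∃[ p ] IsFactorComplexity ν p × (∀ n → p (suc n) ≡ p n + length (R n))
complexity-from-right-special ν R R-lists = p , is-complexity , λ n → refl
  where
  p : ℕ → ℕ
  p zero    = 1
  p (suc n) = p n + length (R n)

  is-complexity : IsFactorComplexity ν p
  is-complexity zero = Vec.[] ∷ [] , [] ∷ [] ,
    (λ { Vec.[] → mk⇔ (λ _ → 0 , refl) (λ _ → here refl) }) , refl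
  is-complexity (suc n) =
    let ws  , ws! , ws⇔ , ws-length = is-complexity n
        ws′ , (ws′! , ws′⇔) , eq    = extend-factors ws (R n) (ws! , ws⇔) (R-lists n)
    in ws′ , ws′! , ws′⇔ , trans eq (cong (_+ length (R n)) ws-length)

-- Runs of zeros

zeros : ℕ → Word
zeros n = replicate n 0F

zeros-+ : ∀ m n w → zeros m ++ zeros n ++ w ≡ zeros (m + n) ++ w
zeros-+ zero    n w = refl
zeros-+ (suc m) n w = cong (0F ∷_) (zeros-+ m n w)

zeros-∷ʳ : ∀ n → zeros n ∷ʳ 0F ≡ zeros (suc n)
zeros-∷ʳ zero    = refl
zeros-∷ʳ (suc n) = cong (0F ∷_) (zeros-∷ʳ n)

zeros-has-no-1 : ∀ n α {β} → zeros n ≡ α ++ 1F ∷ β → ⊥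
zeros-has-no-1 zero    []      ()
zeros-has-no-1 zero    (_ ∷ _) ()
zeros-has-no-1 (suc n) []      ()
zeros-has-no-1 (suc n) (a ∷ α) eq = zeros-has-no-1 n α (∷-injectiveʳ eq)

zeros-1-unique : ∀ m n {u v} → zeros m ++ 1F ∷ u ≡ zeros n ++ 1F ∷ v → m ≡ n
zeros-1-unique zero    zero    eq = refl
zeros-1-unique (suc m) (suc n) eq = cong suc (zeros-1-unique m n (∷-injectiveʳ eq))

zeros-1-cut : ∀ n α {β} → zeros n ++ [ 1F ] ≡ α ++ 1F ∷ β → zeros n ≡ α × β ≡ []
zeros-1-cut zero    []      refl = refl , refl
zeros-1-cut zero    (a ∷ []) ()
zeros-1-cut (suc n) (a ∷ α) eq with ∷-injective eq
... | refl , eq′ with zeros-1-cut n α eq′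
...   | refl , β≡ = refl , β≡

-- The left word starts with exactly `m` zeros, the right one with at least `n + 1`.
zeros-1-< : ∀ m n {u v} → zeros m ++ 1F ∷ u ≡ zeros n ++ 0F ∷ v → n < m
zeros-1-< (suc m) zero    eq = s≤s z≤n
zeros-1-< (suc m) (suc n) eq = s≤s (zeros-1-< m n (∷-injectiveʳ eq))

zeros-< : ∀ m n {v} → zeros m ++ [] ≡ zeros n ++ 0F ∷ v → n < m
zeros-< (suc m) zero    eq = s≤s z≤n
zeros-< (suc m) (suc n) eq = s≤s (zeros-< m n (∷-injectiveʳ eq))

last-1 : ∀ w → (∃[ n ] w ≡ zeros n) ⊎ (∃[ u ] ∃[ n ] w ≡ u ++ 1F ∷ zeros n)
last-1 [] = inj₁ (0 , refl)
last-1 (a ∷ w) with last-1 w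
last-1 (a  ∷ w) | inj₂ (u , n , refl) = inj₂ (a ∷ u , n , refl)
last-1 (0F ∷ w) | inj₁ (n , refl)     = inj₁ (suc n , refl)
last-1 (1F ∷ w) | inj₁ (n , refl)     = inj₂ ([] , n , refl)

No11 : Word → Set
No11 w = ∀ α {β} → w ≢ α ++ 1F ∷ 1F ∷ β

-- The substitution σ̂_n for N = suc N′ and d_n = e.
module Substitution (N′ e : ℕ) where

  N = suc N′

  σ : Letter → Word
  σ 0F = zeros e ++ [ 1F ]
  σ 1F = zeros N

  σ* : Word → Word
  σ* = concatMap σ

  σ*-∷ʳ : ∀ w a → σ* (w ∷ʳ a) ≡ σ* w ++ σ a
  σ*-∷ʳ w a = trans (concatMap-++ σ w [ a ]) (cong (σ* w ++_) (++-identityʳ (σ a)))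

  σ-last : ∀ a → ∃[ w ] σ a ≡ w ∷ʳ opposite a
  σ-last 0F = zeros e , refl
  σ-last 1F = zeros N′ , sym (zeros-∷ʳ N′)

  σ-head : 1 ≤ e → ∀ a → ∃[ w ] σ a ≡ 0F ∷ w
  σ-head (s≤s {n = e′} _) 0F = zeros e′ ++ [ 1F ] , refl
  σ-head (s≤s _)          1F = zeros N′ , refl

  σ-length : ∀ a → 1 ≤ length (σ a)
  σ-length a with σ-last a
  ... | w , eq = subst (1 ≤_) (cong length (sym eq)) (length-++-≤ʳ [ opposite a ] {w})

  σ-last-determined : ∀ u c x a → IsSuffix (u ∷ʳ c) (σ* (x ∷ʳ a)) → c ≡ opposite a
  σ-last-determined u c x a s with σ-last a
  ... | w , eq = ends-in-suffix {u} {σ* x ++ w} (subst (IsSuffix (u ∷ʳ c))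
    (trans (σ*-∷ʳ x a) (trans (cong (σ* x ++_) eq) (sym (++-assoc (σ* x) w [ opposite a ])))) s)

  opposite-injective : ∀ (a b : Letter) → opposite a ≡ opposite b → a ≡ b
  opposite-injective 0F 0F _ = refl
  opposite-injective 0F 1F ()
  opposite-injective 1F 0F ()
  opposite-injective 1F 1F _ = refl

  -- The images of the two letters end in different letters, so the last letter of `u` determines
  -- the last letters of `x` and `y`, which must agree. Either `u` lies within their common last
  -- block, or that block is cancelled and the rest is read backwards in the same way. Each block
  -- uses up at least one letter of `u`, whence the length bound.
  synchronise : ∀ {x y} → Reverse x → Reverse y → ∀ {u} → Reverse u →
    IsSuffix u (σ* x) → IsSuffix u (σ* y) →
    ∃[ v ] IsSuffix v x × IsSuffix v y × IsSuffix u (σ* v) × length v ≤ length u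
  synchronise {x} {y} _ _ [] _ _ =
    [] , (x , ++-identityʳ x) , (y , ++-identityʳ y) , suffix-refl , z≤n
  synchronise [] _ (u ∶ _ ∶ʳ c) (p , eq) _ with () ← ++-conicalʳ u [ c ] (++-conicalʳ p _ eq)
  synchronise (_ ∶ _ ∶ʳ _) [] (u ∶ _ ∶ʳ c) _ (p , eq)
    with () ← ++-conicalʳ u [ c ] (++-conicalʳ p _ eq)
  synchronise (x ∶ rx ∶ʳ a) (y ∶ ry ∶ʳ b) (u ∶ _ ∶ʳ c) s t
    with refl ← opposite-injective a b
      (trans (sym (σ-last-determined u c x a s)) (σ-last-determined u c y b t))
    with suffix-of-++ (σ* x) (subst (IsSuffix (u ∷ʳ c)) (σ*-∷ʳ x a) s)
  ... | inj₁ within = [ a ] , suffix-++ˡ x suffix-refl , suffix-++ˡ y suffix-refl ,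
    subst (IsSuffix (u ∷ʳ c)) (sym (++-identityʳ (σ a))) within , length-++-≤ʳ [ c ] {u}
  ... | inj₂ (u′ , eq , s′) =
    let v , v≤x , v≤y , u′≤σv , v≤u′ = synchronise rx ry (reverseView u′) s′ t′
    in v ∷ʳ a , suffix-++ʳ [ a ] v≤x , suffix-++ʳ [ a ] v≤y ,
       subst₂ IsSuffix (sym eq) (sym (σ*-∷ʳ v a)) (suffix-++ʳ (σ a) u′≤σv) , length-bound v v≤u′
    where
    t′ : IsSuffix u′ (σ* y)
    t′ = suffix-cancelʳ (σ a)
      (subst (λ w → IsSuffix w (σ* y ++ σ a)) eq (subst (IsSuffix (u ∷ʳ c)) (σ*-∷ʳ y a) t))

    length-bound : ∀ v → length v ≤ length u′ → length (v ∷ʳ a) ≤ length (u ∷ʳ c)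
    length-bound v v≤u′ = begin
      length (v ∷ʳ a)             ≡⟨ length-++ v ⟩
      length v + 1                ≤⟨ +-mono-≤ v≤u′ (σ-length a) ⟩
      length u′ + length (σ a)    ≡⟨ length-++ u′ ⟨
      length (u′ ++ σ a)          ≡⟨ cong length eq ⟨
      length (u ∷ʳ c)             ∎
      where open ≤-Reasoning

  -- Only `σ 0F` contains a 1, and it does so as its last letter; hence each 1 in the image marks
  -- the end of a block that comes from a 0.
  cut-at-1 : ∀ x {α β} → σ* x ≡ α ++ 1F ∷ β →
    ∃[ x₁ ] ∃[ x₂ ] x ≡ x₁ ++ 0F ∷ x₂ × σ* x₁ ++ zeros e ≡ α × σ* x₂ ≡ β
  cut-at-1 [] {[]} ()
  cut-at-1 [] {_ ∷ _} ()
  cut-at-1 (a ∷ x) {α} {β} eq with levi (σ a) {q = α} eq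
  ... | inj₂ (r , refl , σx≡) with cut-at-1 x {r} σx≡
  ...   | x₁ , x₂ , refl , refl , σx₂≡ =
    a ∷ x₁ , x₂ , refl , ++-assoc (σ a) (σ* x₁) (zeros e) , σx₂≡
  -- The cut falls between two blocks, so the 1 is the first letter of `σ* x`.
  cut-at-1 (a ∷ x) {α} {β} eq | inj₁ ([] , σa≡ , 1β≡) with cut-at-1 x {[]} (sym 1β≡)
  ...   | x₁ , x₂ , refl , ≡[] , σx₂≡ = a ∷ x₁ , x₂ , refl , (begin
    (σ a ++ σ* x₁) ++ zeros e   ≡⟨ ++-assoc (σ a) (σ* x₁) (zeros e) ⟩
    σ a ++ σ* x₁ ++ zeros e     ≡⟨ cong (σ a ++_) ≡[] ⟩
    σ a ++ []                   ≡⟨ ++-identityʳ (σ a) ⟩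
    σ a                         ≡⟨ σa≡ ⟩
    α ++ []                     ≡⟨ ++-identityʳ α ⟩
    α                           ∎) , σx₂≡
    where open ≡-Reasoning
  cut-at-1 (0F ∷ x) {α} {β} eq | inj₁ (c ∷ r , σa≡ , 1β≡) with ∷-injective 1β≡
  ...   | refl , β≡ with zeros-1-cut e α σa≡
  ...     | α≡ , refl = [] , x , refl , α≡ , sym β≡
  cut-at-1 (1F ∷ x) {α} {β} eq | inj₁ (c ∷ r , σa≡ , 1β≡) with ∷-injective 1β≡
  ...   | refl , β≡ = ⊥-elim (zeros-has-no-1 N α σa≡)

  σ*-0 : ∀ x → σ* (0F ∷ x) ≡ zeros e ++ 1F ∷ σ* x
  σ*-0 x = ++-assoc (zeros e) [ 1F ] (σ* x)

  σ*-10 : ∀ x → σ* (1F ∷ 0F ∷ x) ≡ zeros (N + e) ++ 1F ∷ σ* x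
  σ*-10 x = trans (cong (zeros N ++_) (σ*-0 x)) (zeros-+ N e (1F ∷ σ* x))

  -- By `cut-at-1` a block ends at the first of the two 1s, and for `1 ≤ e` the next block starts
  -- with 0.
  σ*-No11 : 1 ≤ e → ∀ x → No11 (σ* x)
  σ*-No11 (s≤s _) x α eq with cut-at-1 x {α} eq
  ... | _ , [] , _ , _ , ()
  ... | _ , 0F ∷ _ , _ , _ , ()
  ... | _ , 1F ∷ _ , _ , _ , ()

  -- The first 1 of the image closes the block of the first 0 of `x`. Without 11, at most one letter
  -- 1 precedes this 0, and it contributes `N` further zeros.
  run-then-1 : ∀ x m {β} → No11 x → σ* x ≡ zeros m ++ 1F ∷ β →
    (∃[ x′ ] x ≡ 0F ∷ x′ × m ≡ e) ⊎ m ≡ N + e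
  run-then-1 []           zero    no11 ()
  run-then-1 []           (suc m) no11 ()
  run-then-1 (0F ∷ x)     m no11 eq =
    inj₁ (x , refl , zeros-1-unique m e (trans (sym eq) (σ*-0 x)))
  run-then-1 (1F ∷ [])    m no11 eq = ⊥-elim
    (zeros-has-no-1 N (zeros m) (trans (sym (++-identityʳ (zeros N))) eq))
  run-then-1 (1F ∷ 0F ∷ x) m no11 eq =
    inj₂ (zeros-1-unique m (N + e) (trans (sym eq) (σ*-10 x)))
  run-then-1 (1F ∷ 1F ∷ x) m no11 eq = ⊥-elim (no11 [] refl)

  -- According as `x` starts with 0, is the letter 1 alone, or starts with 10, the image has e, N or
  -- N + e leading zeros, and `m + 1` of them are required.
  run-then-0-bound : ∀ x m {β} → No11 x → σ* x ≡ zeros m ++ 0F ∷ β → m < N + e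
  run-then-0-bound []           zero    no11 ()
  run-then-0-bound []           (suc m) no11 ()
  run-then-0-bound (0F ∷ x)     m no11 eq =
    <-≤-trans (zeros-1-< e m (trans (sym (σ*-0 x)) eq)) (m≤n+m e N)
  run-then-0-bound (1F ∷ [])    m no11 eq = <-≤-trans (zeros-< N m eq) (m≤m+n N e)
  run-then-0-bound (1F ∷ 0F ∷ x) m no11 eq = zeros-1-< (N + e) m (trans (sym (σ*-10 x)) eq)
  run-then-0-bound (1F ∷ 1F ∷ x) m no11 eq = ⊥-elim (no11 [] refl)

  run-then-0 : ∀ x {β} → σ* x ≡ zeros e ++ 0F ∷ β → ∃[ x′ ] x ≡ 1F ∷ x′
  run-then-0 []       eq with () ← ++-conicalʳ (zeros e) _ (sym eq)
  run-then-0 (0F ∷ x) eq = ⊥-elim (n≮n e (zeros-1-< e e (trans (sym (σ*-0 x)) eq)))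
  run-then-0 (1F ∷ x) eq = x , refl

  -- Extending the run leftwards to the last 1 of `α` makes it start at a block boundary, where
  -- `run-then-0-bound` applies to the remaining part of `x`.
  run-bound : ∀ x α m {β} → No11 x → σ* x ≡ α ++ zeros m ++ 0F ∷ β → m < N + e
  run-bound x α m {β} no11 eq with last-1 α
  ... | inj₁ (k , refl) = ≤-<-trans (m≤n+m m k)
    (run-then-0-bound x (k + m) no11 (trans eq (zeros-+ k m (0F ∷ β))))
  ... | inj₂ (u , k , refl) with cut-at-1 x {u} (trans eq (++-assoc u (1F ∷ zeros k) _))
  ...   | x₁ , x₂ , refl , _ , σx₂≡ = ≤-<-trans (m≤n+m m k)
    (run-then-0-bound x₂ (k + m) (λ γ eq′ → no11 (x₁ ++ 0F ∷ γ)
        (trans (cong (λ z → x₁ ++ 0F ∷ z) eq′) (sym (++-assoc x₁ (0F ∷ γ) _))))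
      (trans σx₂≡ (zeros-+ k m (0F ∷ β))))

-- Dual sequences

image-⊑ : ∀ {h μ ν v} → IsImage h μ ν → v ⊑ μ → concatMap h v ⊑ ν
image-⊑ {h} {μ} {ν} {v} image (m , α , β , eq) =
  ⊑-++ʳ (concatMap h v) (⊑-++ˡ (concatMap h α) (subst (_⊑ ν) (begin
    concatMap h (prefix μ m)                            ≡⟨ cong (concatMap h) eq ⟩
    concatMap h (α ++ v ++ β)                           ≡⟨ concatMap-++ h α (v ++ β) ⟩
    concatMap h α ++ concatMap h (v ++ β)               ≡⟨ cong (concatMap h α ++_) (concatMap-++ h v β) ⟩
    concatMap h α ++ concatMap h v ++ concatMap h β     ∎)
    (subst (_⊑ ν) (image m) (⊑-prefix ν _))))
  where open ≡-Reasoning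

concatMap-length : ∀ (h : Letter → Word) → (∀ a → 1 ≤ length (h a)) → ∀ w →
  length w ≤ length (concatMap h w)
concatMap-length h h≥1 []      = z≤n
concatMap-length h h≥1 (a ∷ w) = ≤-trans (+-mono-≤ (h≥1 a) (concatMap-length h h≥1 w))
  (≤-reflexive (sym (length-++ (h a))))

-- With non-empty blocks, the image of the first `m` letters of `μ` has length at least `m`, so it
-- covers the prefix of `ν` in which `w` was found.
preimage-⊑ : ∀ {h μ ν w} → (∀ a → 1 ≤ length (h a)) → IsImage h μ ν → w ⊑ ν →
  ∃[ x ] x ⊑ μ × ∃[ α ] ∃[ β ] concatMap h x ≡ α ++ w ++ β
preimage-⊑ {h} {μ} {ν} {w} h≥1 image (m , α , β , eq) =
  prefix μ m , ⊑-prefix μ m , α , β ++ rest , (begin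
    concatMap h (prefix μ m)        ≡⟨ image m ⟨
    prefix ν ℓ                      ≡⟨ cong (prefix ν) (m+[n∸m]≡n m≤ℓ) ⟨
    prefix ν (m + (ℓ ∸ m))          ≡⟨ applyUpTo-+ ν m (ℓ ∸ m) ⟩
    prefix ν m ++ rest              ≡⟨ cong (_++ rest) eq ⟩
    (α ++ w ++ β) ++ rest           ≡⟨ ++-assoc α (w ++ β) rest ⟩
    α ++ (w ++ β) ++ rest           ≡⟨ cong (α ++_) (++-assoc w β rest) ⟩
    α ++ w ++ β ++ rest             ∎)
  where
  open ≡-Reasoning
  ℓ = length (concatMap h (prefix μ m))
  rest = applyUpTo (λ j → ν (m + j)) (ℓ ∸ m)
  m≤ℓ : m ≤ ℓ
  m≤ℓ = subst (_≤ ℓ) (length-applyUpTo μ m) (concatMap-length h h≥1 (prefix μ m))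

prefix-head : ∀ ν {w a w′} → w ≡ a ∷ w′ → prefix ν (length w) ≡ w → ν 0 ≡ a
prefix-head ν refl eq = ∷-injectiveˡ eq

zeros-suffix : ∀ {m n} → m ≤ n → IsSuffix (zeros m) (zeros n)
zeros-suffix m≤n = go (≤⇒≤′ m≤n)
  where
  go : ∀ {m n} → m ≤′ n → IsSuffix (zeros m) (zeros n)
  go ≤′-refl       = suffix-refl
  go (≤′-step m≤n) = suffix-++ˡ [ 0F ] (go m≤n)

No11-⊑ : ∀ {μ x} → ¬ (1F ∷ 1F ∷ [] ⊑ μ) → x ⊑ μ → No11 x
No11-⊑ ¬11 x⊑μ α refl = ¬11 (⊑-++ʳ (1F ∷ 1F ∷ []) (⊑-++ˡ α x⊑μ))

concatMap-^ʷ : ∀ h w n → concatMap h (w ^ʷ n) ≡ concatMap h w ^ʷ n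
concatMap-^ʷ h w zero    = refl
concatMap-^ʷ h w (suc n) =
  trans (concatMap-++ h w (w ^ʷ n)) (cong (concatMap h w ++_) (concatMap-^ʷ h w n))

[0]^ʷ : ∀ n → [ 0F ] ^ʷ n ≡ zeros n
[0]^ʷ zero    = refl
[0]^ʷ (suc n) = cong (0F ∷_) ([0]^ʷ n)

length-^ʷ : ∀ w n → length (w ^ʷ n) ≡ n * length w
length-^ʷ w zero    = refl
length-^ʷ w (suc n) = trans (length-++ w) (cong (λ m → length w + m) (length-^ʷ w n))

EndsIn : Letter → Word → Set
EndsIn a w = IsSuffix [ a ] w

EndsIn-^ʷ : ∀ {a w n} → 1 ≤ n → EndsIn a w → EndsIn a (w ^ʷ n)
EndsIn-^ʷ {a} {w} {suc zero}    _ s = subst (EndsIn a) (sym (++-identityʳ w)) s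
EndsIn-^ʷ {a} {w} {suc (suc n)} _ s = suffix-++ˡ w (EndsIn-^ʷ {n = suc n} (s≤s z≤n) s)

EndsIn-concatMap : ∀ {h : Letter → Word} {a b w} → EndsIn b (h a) → EndsIn a w →
  EndsIn b (concatMap h w)
EndsIn-concatMap {h} {a} {w = w} s t = suffix-trans s
  (subst (λ u → IsSuffix u (concatMap h w)) (++-identityʳ (h a)) (suffix-concatMap h {v = w} t))

-- Passing from one level of the dual sequence to the next

module Levels (N′ : ℕ) where

  private
    N = suc N′

  σ : ℕ → Letter → Word
  σ = Substitution.σ N′

  σ* : ℕ → Word → Word
  σ* = Substitution.σ* N′

  module D (d : ℕ → ℕ) = Dual N d

  σ̂≗σ : ∀ d n → D.σ̂ d n ≗ σ (d n)
  σ̂≗σ d n 0F = refl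
  σ̂≗σ d n 1F = refl

  σ̂-shift : ∀ d n → D.σ̂ d (suc n) ≗ D.σ̂ (d ∘ suc) n
  σ̂-shift d n 0F = refl
  σ̂-shift d n 1F = refl

  -- The recursion of `σ̂∘` splits off the innermost substitution. Descent from `ωs 0` to `ωs 1`
  -- calls for splitting off the outermost one, which leaves the composition for the shifted digits.
  σ̂∘-shift : ∀ d n w → D.σ̂∘ d (suc n) w ≡ σ* (d 0) (D.σ̂∘ (d ∘ suc) n w)
  σ̂∘-shift d zero    w = concatMap-cong (σ̂≗σ d 0) w
  σ̂∘-shift d (suc n) w = trans (σ̂∘-shift d n (concatMap (D.σ̂ d (suc n)) w))
    (cong (σ* (d 0) ∘ D.σ̂∘ (d ∘ suc) n) (concatMap-cong (σ̂-shift d n) w))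

  Σ̂^-shift : ∀ d k n → D.Σ̂ d (suc k) ^ʷ n ≡ σ* (d 0) (D.Σ̂ (d ∘ suc) k ^ʷ n)
  Σ̂^-shift d k n = trans (cong (_^ʷ n) (σ̂∘-shift d k [ 0F ]))
    (sym (concatMap-^ʷ (σ (d 0)) (D.Σ̂ (d ∘ suc) k) n))

  Σ̂^-++-shift : ∀ d k n u → D.Σ̂ d (suc k) ^ʷ n ++ σ* (d 0) u ++ zeros (d 0) ≡
    σ* (d 0) (D.Σ̂ (d ∘ suc) k ^ʷ n ++ u) ++ zeros (d 0)
  Σ̂^-++-shift d k n u = begin
    D.Σ̂ d (suc k) ^ʷ n ++ σ* e u ++ zeros e            ≡⟨ cong (_++ σ* e u ++ zeros e) (Σ̂^-shift d k n) ⟩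
    σ* e (D.Σ̂ (d ∘ suc) k ^ʷ n) ++ σ* e u ++ zeros e   ≡⟨ ++-assoc (σ* e (D.Σ̂ (d ∘ suc) k ^ʷ n)) (σ* e u) (zeros e) ⟨
    (σ* e (D.Σ̂ (d ∘ suc) k ^ʷ n) ++ σ* e u) ++ zeros e ≡⟨ cong (_++ zeros e) (concatMap-++ (σ e) (D.Σ̂ (d ∘ suc) k ^ʷ n) u) ⟨
    σ* e (D.Σ̂ (d ∘ suc) k ^ʷ n ++ u) ++ zeros e        ∎
    where
    open ≡-Reasoning
    e = d 0

  -- All powers in the product except the last are images under the first substitution; the last one
  -- is a power of the letter 0 and gives the trailing zeros.
  Ŝ-shift : ∀ d k → D.Ŝ d (suc k) ≡ σ* (d 0) (D.Ŝ (d ∘ suc) k) ++ zeros (d 0)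
  Ŝ-shift d zero    = trans (++-identityʳ _) ([0]^ʷ (d 0))
  Ŝ-shift d (suc k) = trans (cong (D.Σ̂ d (suc k) ^ʷ d (suc k) ++_) (Ŝ-shift d k))
    (Σ̂^-++-shift d k (d (suc k)) (D.Ŝ (d ∘ suc) k))

  T̂-zero : ∀ d → D.T̂₊ d 0 ≡ zeros (N′ + d 0)
  T̂-zero d = begin
    [ 0F ] ^ʷ N′ ++ [ 0F ] ^ʷ d 0 ++ []   ≡⟨ cong₂ (λ u v → u ++ v ++ []) ([0]^ʷ N′) ([0]^ʷ (d 0)) ⟩
    zeros N′ ++ zeros (d 0) ++ []         ≡⟨ zeros-+ N′ (d 0) [] ⟩
    zeros (N′ + d 0) ++ []                ≡⟨ ++-identityʳ _ ⟩
    zeros (N′ + d 0)                      ∎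
    where open ≡-Reasoning

  T̂-shift : ∀ d k → D.T̂₊ d (suc k) ≡ σ* (d 0) (D.T̂₊ (d ∘ suc) k) ++ zeros (d 0)
  T̂-shift d k = trans (cong (D.Σ̂ d (suc k) ^ʷ N′ ++_) (Ŝ-shift d (suc k)))
    (Σ̂^-++-shift d k N′ (D.Ŝ (d ∘ suc) (suc k)))

  -- All desubstitutions of a sequence together with the bound on the digits. Statements below
  -- concern `ωs 0` for every chain, so that an induction can apply them to `shift`.
  record Chain (d : ℕ → ℕ) (ωs : ℕ → InfWord) : Set where
    field
      digits : ∀ n → N ≤ d n
      images : ∀ n → IsImage (σ (d n)) (ωs (suc n)) (ωs n)

    digits≥1 : ∀ n → 1 ≤ d n
    digits≥1 n = ≤-trans (s≤s z≤n) (digits n)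

    shift : Chain (d ∘ suc) (ωs ∘ suc)
    shift = record { digits = digits ∘ suc ; images = images ∘ suc }

    desubstitute : ∀ {w} → w ⊑ ωs 0 →
      ∃[ x ] x ⊑ ωs 1 × ∃[ α ] ∃[ β ] σ* (d 0) x ≡ α ++ w ++ β
    desubstitute = preimage-⊑ (Substitution.σ-length N′ (d 0)) (images 0)

    no-11 : ¬ (1F ∷ 1F ∷ [] ⊑ ωs 0)
    no-11 f = let x , _ , α , β , eq = desubstitute f
              in Substitution.σ*-No11 N′ (d 0) (digits≥1 0) x α eq

    starts-with-0 : ωs 0 0 ≡ 0F
    starts-with-0 = prefix-head (ωs 0)
      (cong (_++ []) (proj₂ (Substitution.σ-head N′ (d 0) (digits≥1 0) (ωs 1 0)))) (images 0 1)

  open Chain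

  -- The sequence `ωs 1` starts with 0, whose block ends in 1, and the block after it starts with 0.
  10-⊑ : ∀ {d ωs} → Chain d ωs → 1F ∷ 0F ∷ [] ⊑ ωs 0
  10-⊑ {d} {ωs} c = ⊑-++ʳ (1F ∷ 0F ∷ []) {w ++ []} (⊑-++ˡ (zeros e) (subst (_⊑ ωs 0) (begin
    σ* e (ωs 1 0 ∷ ωs 1 1 ∷ [])            ≡⟨ cong (λ a → σ* e (a ∷ ωs 1 1 ∷ [])) (starts-with-0 (shift c)) ⟩
    σ* e (0F ∷ ωs 1 1 ∷ [])                ≡⟨ Substitution.σ*-0 N′ e (ωs 1 1 ∷ []) ⟩
    zeros e ++ 1F ∷ σ e (ωs 1 1) ++ []     ≡⟨ cong (λ u → zeros e ++ 1F ∷ u ++ []) (proj₂ head) ⟩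
    zeros e ++ 1F ∷ 0F ∷ w ++ []           ∎)
    (image-⊑ (images c 0) (⊑-prefix (ωs 1) 2))))
    where
    open ≡-Reasoning
    e = d 0
    head = Substitution.σ-head N′ e (digits≥1 c 0) (ωs 1 1)
    w = proj₁ head

  -- For `k = 0`, the image of 10 is a run of N + d₁ zeros followed by 1, and it contains both
  -- extensions. In the step, t0 yields σ̂₁(t)0^{d₁}1. As 11 does not occur, t1 is followed by 0,
  -- and t10 yields σ̂₁(t)0^{d₁+N}1, which contains the extension by 0.
  T̂-right-special : ∀ k {d ωs} → Chain d ωs → RightSpecial (ωs 0) (D.T̂₊ d k)
  T̂-right-special zero {d} {ωs} c = subst (RightSpecial (ωs 0)) (sym (T̂-zero d)) λ where
      0F → subst (_⊑ ωs 0) (sym (zeros-∷ʳ (N′ + d 0))) (⊑-++ʳ (zeros (N + d 0)) run)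
      1F → ⊑-++ˡ [ 0F ] run
    where
    run : zeros (N + d 0) ∷ʳ 1F ⊑ ωs 0
    run = subst (_⊑ ωs 0) (Substitution.σ*-10 N′ (d 0) [])
      (image-⊑ (images c 0) (10-⊑ (shift c)))
  T̂-right-special (suc k) {d} {ωs} c = subst (RightSpecial (ωs 0)) (sym (T̂-shift d k)) λ where
      0F → then-0 (⊑-extend (rs 1F))
      1F → subst (_⊑ ωs 0)
        (trans (Substitution.σ*-∷ʳ N′ e t 0F) (sym (++-assoc (σ* e t) (zeros e) [ 1F ])))
        (image-⊑ (images c 0) (rs 0F))
    where
    open ≡-Reasoning
    e = d 0
    t = D.T̂₊ (d ∘ suc) k
    rs : RightSpecial (ωs 1) t
    rs = T̂-right-special k (shift c)

    then-0 : ∃[ a ] (t ∷ʳ 1F) ∷ʳ a ⊑ ωs 1 → (σ* e t ++ zeros e) ∷ʳ 0F ⊑ ωs 0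
    then-0 (1F , f) = ⊥-elim (no-11 (shift c) (⊑-++ˡ t (subst (_⊑ ωs 1) (++-assoc t [ 1F ] [ 1F ]) f)))
    then-0 (0F , f) = ⊑-++ʳ _ {zeros N′ ++ [ 1F ]} (subst (_⊑ ωs 0) (begin
      σ* e ((t ∷ʳ 1F) ∷ʳ 0F)                            ≡⟨ cong (σ* e) (++-assoc t [ 1F ] [ 0F ]) ⟩
      σ* e (t ++ 1F ∷ 0F ∷ [])                          ≡⟨ concatMap-++ (σ e) t (1F ∷ 0F ∷ []) ⟩
      σ* e t ++ σ* e (1F ∷ 0F ∷ [])                     ≡⟨ cong (σ* e t ++_) (Substitution.σ*-10 N′ e []) ⟩
      σ* e t ++ zeros (N + e) ++ [ 1F ]                 ≡⟨ cong (λ m → σ* e t ++ zeros m ++ [ 1F ]) (+-comm N e) ⟩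
      σ* e t ++ zeros (e + N) ++ [ 1F ]                 ≡⟨ cong (σ* e t ++_) (zeros-+ e N [ 1F ]) ⟨
      σ* e t ++ zeros e ++ 0F ∷ zeros N′ ++ [ 1F ]      ≡⟨ ++-assoc (σ* e t) (zeros e) _ ⟨
      (σ* e t ++ zeros e) ++ 0F ∷ zeros N′ ++ [ 1F ]    ≡⟨ ∷ʳ-++ (σ* e t ++ zeros e) 0F _ ⟨
      (σ* e t ++ zeros e) ∷ʳ 0F ++ zeros N′ ++ [ 1F ]   ∎)
      (image-⊑ (images c 0) f))

  -- Runs of zeros between two 1s have length d₁ or N + d₁, so 0ᵐ is followed by both letters only
  -- if m = d₁; then 0 comes from σ̂₁(1) and 1 from σ̂₁(0).
  right-special-desubstitution : ∀ {d ωs} → Chain d ωs → ∀ u m → RightSpecial (ωs 0) (u ++ 1F ∷ zeros m) →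
    m ≡ d 0 × ∃[ v ] RightSpecial (ωs 1) v × IsSuffix (u ∷ʳ 1F) (σ* (d 0) v) × length v ≤ length (u ∷ʳ 1F)
  right-special-desubstitution {d} {ωs} c u m rs =
    let x , x⊑ , α , β , x≡ = desubstitute c (rs 0F)
        y , y⊑ , γ , δ , y≡ = desubstitute c (rs 1F)
    in go x⊑ α x≡ y⊑ γ y≡
    where
    e = d 0
    open Substitution N′ e using (σ*-∷ʳ; cut-at-1; run-then-0; run-then-0-bound; run-then-1; synchronise)

    regroup : ∀ α a β → α ++ ((u ++ 1F ∷ zeros m) ∷ʳ a) ++ β ≡ (α ++ u) ++ 1F ∷ zeros m ++ a ∷ β
    regroup α a β = begin
      α ++ ((u ++ 1F ∷ zeros m) ∷ʳ a) ++ β   ≡⟨ cong (α ++_) (∷ʳ-++ (u ++ 1F ∷ zeros m) a β) ⟩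
      α ++ (u ++ 1F ∷ zeros m) ++ a ∷ β      ≡⟨ cong (α ++_) (++-assoc u (1F ∷ zeros m) (a ∷ β)) ⟩
      α ++ u ++ 1F ∷ zeros m ++ a ∷ β        ≡⟨ ++-assoc α u _ ⟨
      (α ++ u) ++ 1F ∷ zeros m ++ a ∷ β      ∎
      where open ≡-Reasoning

    ends-block : ∀ α x → σ* e x ++ zeros e ≡ α ++ u → IsSuffix (u ∷ʳ 1F) (σ* e (x ∷ʳ 0F))
    ends-block α x eq = α , (begin
      α ++ (u ∷ʳ 1F)                ≡⟨ ++-assoc α u [ 1F ] ⟨
      (α ++ u) ∷ʳ 1F                ≡⟨ cong (_∷ʳ 1F) eq ⟨
      (σ* e x ++ zeros e) ∷ʳ 1F     ≡⟨ ++-assoc (σ* e x) (zeros e) [ 1F ] ⟩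
      σ* e x ++ σ e 0F              ≡⟨ σ*-∷ʳ x 0F ⟨
      σ* e (x ∷ʳ 0F)                ∎)
      where open ≡-Reasoning

    occurs : ∀ {v} x a z → IsSuffix v (x ∷ʳ 0F) → x ++ 0F ∷ a ∷ z ⊑ ωs 1 → v ∷ʳ a ⊑ ωs 1
    occurs x a z s f = ⊑-suffix (suffix-++ʳ [ a ] s)
      (⊑-++ʳ ((x ∷ʳ 0F) ∷ʳ a) (subst (_⊑ ωs 1)
        (sym (trans (∷ʳ-++ (x ∷ʳ 0F) a z) (∷ʳ-++ x 0F (a ∷ z)))) f))

    tail-No11 : ∀ x {z} → x ++ 0F ∷ z ⊑ ωs 1 → No11 z
    tail-No11 x {z} f = No11-⊑ (no-11 (shift c)) (⊑-++ˡ [ 0F ] (⊑-++ˡ x f))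

    go : ∀ {x y} → x ⊑ ωs 1 → ∀ α {β} → σ* e x ≡ α ++ ((u ++ 1F ∷ zeros m) ∷ʳ 0F) ++ β →
      y ⊑ ωs 1 → ∀ γ {δ} → σ* e y ≡ γ ++ ((u ++ 1F ∷ zeros m) ∷ʳ 1F) ++ δ →
      m ≡ e × ∃[ v ] RightSpecial (ωs 1) v × IsSuffix (u ∷ʳ 1F) (σ* e v) × length v ≤ length (u ∷ʳ 1F)
    go {x} {y} x⊑ α {β} x≡ y⊑ γ {δ} y≡
      with cut-at-1 x {α ++ u} (trans x≡ (regroup α 0F β)) | cut-at-1 y {γ ++ u} (trans y≡ (regroup γ 1F δ))
    ... | x₁ , x₂ , refl , αu≡ , x₂≡ | y₁ , y₂ , refl , γu≡ , y₂≡
      with run-then-1 y₂ m (tail-No11 y₁ y⊑) y₂≡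
    ... | inj₂ refl = ⊥-elim (n≮n m (run-then-0-bound x₂ m (tail-No11 x₁ x⊑) x₂≡))
    ... | inj₁ (y₃ , refl , refl) with run-then-0 x₂ x₂≡
    ...   | x₃ , refl =
      -- The last 1 of the given word closes the block of a 0 in both preimages, so `u ∷ʳ 1F` is a
      -- common suffix of the images of `x₁ ∷ʳ 0F` and `y₁ ∷ʳ 0F`.
      let v , v≤x , v≤y , u1≤σv , v≤u1 =
            synchronise (reverseView (x₁ ∷ʳ 0F)) (reverseView (y₁ ∷ʳ 0F)) (reverseView (u ∷ʳ 1F))
              (ends-block α x₁ αu≡) (ends-block γ y₁ γu≡)
      in refl , v ,
         (λ { 0F → occurs y₁ 0F y₃ v≤y y⊑ ; 1F → occurs x₁ 1F x₃ v≤x x⊑ }) , u1≤σv , v≤u1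

  -- Induction on a bound for the length, as the word `v` at the next level is shorter but not a
  -- subterm. A word of zeros is bounded by `run-bound` and fits into `T̂₊ 0`; any other is
  -- desubstituted to `v`, and `T̂-shift` carries the suffix relation back.
  right-special-suffix : ∀ n {d ωs} → Chain d ωs → ∀ w → length w ≤ n → RightSpecial (ωs 0) w →
    ∃[ k ] IsSuffix w (D.T̂₊ d k)
  right-special-suffix n {d} c w w≤n rs with last-1 w
  right-special-suffix n {d} c _ w≤n rs | inj₁ (m , refl) =
    let x , x⊑ , α , β , eq = desubstitute c (rs 0F)
        m<N+d = Substitution.run-bound N′ (d 0) x α m (No11-⊑ (no-11 (shift c)) x⊑)
                  (trans eq (cong (α ++_) (∷ʳ-++ (zeros m) 0F β)))
    in 0 , subst (IsSuffix (zeros m)) (sym (T̂-zero d)) (zeros-suffix (s≤s⁻¹ m<N+d))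
  right-special-suffix n {d} c _ w≤n rs | inj₂ (u , m , refl)
    with right-special-desubstitution c u m rs
  ... | refl , v , v-rs , u1≤σv , v≤u1 = descend n (≤-trans shorter w≤n)
    where
    e = d 0
    w≡ : (u ∷ʳ 1F) ++ zeros e ≡ u ++ 1F ∷ zeros e
    w≡ = ∷ʳ-++ u 1F (zeros e)

    shorter : length v < length (u ++ 1F ∷ zeros e)
    shorter = begin-strict
      length v                            ≤⟨ v≤u1 ⟩
      length (u ∷ʳ 1F)                    <⟨ m<m+n _ (digits≥1 c 0) ⟩
      length (u ∷ʳ 1F) + e                ≡⟨ cong (λ m → length (u ∷ʳ 1F) + m) (length-replicate e) ⟨
      length (u ∷ʳ 1F) + length (zeros e) ≡⟨ length-++ (u ∷ʳ 1F) ⟨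
      length ((u ∷ʳ 1F) ++ zeros e)       ≡⟨ cong length w≡ ⟩
      length (u ++ 1F ∷ zeros e)          ∎
      where open ≤-Reasoning

    descend : ∀ n → length v < n → ∃[ k ] IsSuffix (u ++ 1F ∷ zeros e) (D.T̂₊ d k)
    descend (suc n) (s≤s v≤n) =
      let k , v≤t = right-special-suffix n (shift c) v v≤n v-rs
      in suc k , subst₂ IsSuffix w≡ (sym (T̂-shift d k))
           (suffix-++ʳ (zeros e) (suffix-trans u1≤σv (suffix-concatMap (σ e) v≤t)))

-- Counting right special factors

suffix-vec : ∀ {n w} → n ≤ length w → Σ[ v ∈ Vec Letter n ] IsSuffix (toList v) w
suffix-vec {zero}  {w} _ = Vec.[] , w , ++-identityʳ w
suffix-vec {suc n} {w} n≤w with m≤n⇒m<n∨m≡n n≤w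
suffix-vec {suc n} {a ∷ w} _ | inj₁ (s≤s n≤w) with suffix-vec {suc n} {w} n≤w
... | v , s = v , suffix-++ˡ [ a ] s
suffix-vec {suc n} {a ∷ w} _ | inj₂ refl = Vec.fromList (a ∷ w) , [] , Vec.toList∘fromList (a ∷ w)

suffix-vec-unique : ∀ {n w} (u v : Vec Letter n) →
  IsSuffix (toList u) w → IsSuffix (toList v) w → u ≡ v
suffix-vec-unique u v s t = toList-injective (suffix-same-length
  (suffix-comparable s t (≤-reflexive (trans (Vec.length-toList u) (sym (Vec.length-toList v)))))
  (≤-reflexive (trans (Vec.length-toList v) (sym (Vec.length-toList u)))))

suffix-of-suffix : ∀ {n w x} (v : Vec Letter n) → n ≤ length x →
  IsSuffix (toList v) w → IsSuffix x w → IsSuffix (toList v) x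
suffix-of-suffix {x = x} v n≤x s t =
  suffix-comparable s t (subst (_≤ length x) (sym (Vec.length-toList v)) n≤x)

-- The interleaving of the lengths ŝ and t̂

module Lengths (N′ : ℕ) (d : ℕ → ℕ) (N≤d : ∀ n → suc N′ ≤ d n) where
  open Dual (suc N′) d

  1≤d : ∀ n → 1 ≤ d n
  1≤d n = ≤-trans (s≤s z≤n) (N≤d n)

  σ̂∘-++ : ∀ n u v → σ̂∘ n (u ++ v) ≡ σ̂∘ n u ++ σ̂∘ n v
  σ̂∘-++ zero    u v = refl
  σ̂∘-++ (suc n) u v =
    trans (cong (σ̂∘ n) (concatMap-++ (σ̂ n) u v)) (σ̂∘-++ n (concatMap (σ̂ n) u) (concatMap (σ̂ n) v))

  -- Since `1 ≤ d k`, the word `σ̂ k 0F` starts with 0, so `Σ̂ k` is a prefix of `Σ̂ (suc k)`.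
  Σ̂-length-mono : ∀ k → length (Σ̂ k) ≤ length (Σ̂ (suc k))
  Σ̂-length-mono k with d k | 1≤d k
  ... | suc e | _ = subst (length (Σ̂ k) ≤_)
    (cong length (sym (σ̂∘-++ k [ 0F ] ((replicate e 0F ++ [ 1F ]) ++ []))))
    (length-++-≤ˡ (Σ̂ k))

  Σ̂-length≥1 : ∀ k → 1 ≤ length (Σ̂ k)
  Σ̂-length≥1 zero    = s≤s z≤n
  Σ̂-length≥1 (suc k) = ≤-trans (Σ̂-length≥1 k) (Σ̂-length-mono k)

  Ŝ-suffix : ∀ {k l} → k ≤ l → IsSuffix (Ŝ k) (Ŝ l)
  Ŝ-suffix k≤l = go (≤⇒≤′ k≤l)
    where
    go : ∀ {k l} → k ≤′ l → IsSuffix (Ŝ k) (Ŝ l)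
    go ≤′-refl            = suffix-refl
    go (≤′-step {l} k≤l)  = suffix-++ˡ (Σ̂ l ^ʷ d l) (go k≤l)

  Ŝ-suffix-T̂ : ∀ {k l} → k ≤ l → IsSuffix (Ŝ (suc k)) (T̂₊ l)
  Ŝ-suffix-T̂ {l = l} k≤l = suffix-++ˡ (Σ̂ l ^ʷ N′) (Ŝ-suffix (s≤s k≤l))

  ŝ-mono : ∀ {k l} → k ≤ l → ŝ k ≤ ŝ l
  ŝ-mono k≤l = suffix-length (Ŝ-suffix k≤l)

  ŝ≤t̂ : ∀ k → ŝ k ≤ t̂ k
  ŝ≤t̂ zero    = z≤n
  ŝ≤t̂ (suc k) = suffix-length (Ŝ-suffix-T̂ {k} ≤-refl)

  -- In the successor case both words end in `Ŝ (suc k)`. Before it stand N - 1 copies of `Σ̂ k` in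
  -- one, and in the other at least N copies of `Σ̂ (suc k)`, which is no shorter.
  t̂<ŝ : ∀ k → t̂ k < ŝ (suc k)
  t̂<ŝ zero = begin-strict
    0                            <⟨ 1≤d 0 ⟩
    d 0                          ≡⟨ *-identityʳ (d 0) ⟨
    d 0 * 1                      ≡⟨ length-^ʷ [ 0F ] (d 0) ⟨
    length ([ 0F ] ^ʷ d 0)       ≤⟨ length-++-≤ˡ ([ 0F ] ^ʷ d 0) ⟩
    ŝ 1                          ∎
    where open ≤-Reasoning
  t̂<ŝ (suc k) = begin-strict
    length (Σ̂ k ^ʷ N′ ++ Ŝ (suc k))               ≡⟨ length-++ (Σ̂ k ^ʷ N′) ⟩
    length (Σ̂ k ^ʷ N′) + ŝ (suc k)                ≡⟨ cong (_+ ŝ (suc k)) (length-^ʷ (Σ̂ k) N′) ⟩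
    N′ * length (Σ̂ k) + ŝ (suc k)                 <⟨ +-monoˡ-< (ŝ (suc k)) (+-monoˡ-≤ (N′ * length (Σ̂ k)) (Σ̂-length≥1 k)) ⟩
    suc N′ * length (Σ̂ k) + ŝ (suc k)             ≤⟨ +-monoˡ-≤ (ŝ (suc k)) (*-mono-≤ (N≤d (suc k)) (Σ̂-length-mono k)) ⟩
    d (suc k) * length (Σ̂ (suc k)) + ŝ (suc k)    ≡⟨ cong (_+ ŝ (suc k)) (length-^ʷ (Σ̂ (suc k)) (d (suc k))) ⟨
    length (Σ̂ (suc k) ^ʷ d (suc k)) + ŝ (suc k)   ≡⟨ length-++ (Σ̂ (suc k) ^ʷ d (suc k)) ⟨
    ŝ (suc (suc k))                               ∎
    where open ≤-Reasoning

  t̂<t̂ : ∀ k → t̂ k < t̂ (suc k)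
  t̂<t̂ k = <-≤-trans (t̂<ŝ k) (ŝ≤t̂ (suc k))

  t̂-mono : ∀ {k l} → k ≤ l → t̂ k ≤ t̂ l
  t̂-mono k≤l = go (≤⇒≤′ k≤l)
    where
    go : ∀ {k l} → k ≤′ l → t̂ k ≤ t̂ l
    go ≤′-refl            = ≤-refl
    go (≤′-step {l} k≤l)  = ≤-trans (go k≤l) (<⇒≤ (t̂<t̂ l))

  k≤t̂ : ∀ k → k ≤ t̂ k
  k≤t̂ zero    = z≤n
  k≤t̂ (suc k) = ≤-<-trans (k≤t̂ k) (t̂<t̂ k)

  -- By `k≤t̂`, the bound `t̂ n` is at least `n`; descending from it to the first `t̂ k` below `n`
  -- finds the interval.
  cases : ∀ n → 1 ≤ n → Case₁ n ⊎ Case₂ n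
  cases n 1≤n = search n (k≤t̂ n)
    where
    search : ∀ k → n ≤ t̂ k → Case₁ n ⊎ Case₂ n
    search zero    n≤0 = ⊥-elim (<⇒≱ 1≤n n≤0)
    search (suc k) n≤t with n ≤? t̂ k | n ≤? ŝ (suc k)
    ... | yes n≤t′ | _       = search k n≤t′
    ... | no  n≰t′ | yes n≤s = inj₁ (k , ≰⇒> n≰t′ , n≤s)
    ... | no  _    | no  n≰s = inj₂ (k , ≰⇒> n≰s , n≤t)

  cases-exclusive : ∀ {n} → Case₁ n → Case₂ n → ⊥
  cases-exclusive {n} (j , t<n , n≤s) (k , s<n , n≤t) with j ≤? k
  ... | yes j≤k = <⇒≱ s<n (≤-trans n≤s (ŝ-mono (s≤s j≤k)))
  ... | no  j≰k = <⇒≱ t<n (≤-trans n≤t (t̂-mono (≰⇒> j≰k)))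

-- The words 0 and 0^{d₁}1 end in different letters, and each further outermost substitution
-- exchanges the two last letters.
last-letters : ∀ N′ k d → let open Dual (suc N′) d in
  ∃[ a ] EndsIn a (Σ̂ k) × EndsIn (opposite a) (Σ̂ (suc k))
last-letters N′ zero d = 0F , suffix-refl ,
  subst (EndsIn 1F) (sym (++-identityʳ _)) (suffix-++ˡ (replicate (d 0) 0F) suffix-refl)
last-letters N′ (suc k) d = let a , s , t = last-letters N′ k (d ∘ suc) in
  opposite a , lift k a s , lift (suc k) (opposite a) t
  where
  lift : ∀ k a → EndsIn a (Dual.Σ̂ (suc N′) (d ∘ suc) k) → EndsIn (opposite a) (Dual.Σ̂ (suc N′) d (suc k))
  lift k a s with Substitution.σ-last N′ (d 0) a
  ... | w , eq = subst (EndsIn (opposite a)) (sym (Levels.σ̂∘-shift N′ d k [ 0F ]))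
    (EndsIn-concatMap (w , sym eq) s)

-- The right special factors of each length

module RightSpecials (N′ : ℕ) (1≤N′ : 1 ≤ N′)
  {d : ℕ → ℕ} {ωs : ℕ → InfWord} (c : Levels.Chain N′ d ωs) where
  open Levels.Chain c using () renaming (digits to N≤d)
  open Dual (suc N′) d
  open Lengths N′ d N≤d

  ω = ωs 0

  T̂-suffix-special : ∀ {u} k → IsSuffix u (T̂₊ k) → RightSpecial ω u
  T̂-suffix-special k s = RightSpecial-suffix s (Levels.T̂-right-special N′ k c)

  special-suffix : ∀ {n} (v : Vec Letter n) → RightSpecial ω (toList v) →
    ∃[ k ] n ≤ t̂ (suc k) × IsSuffix (toList v) (T̂₊ k)
  special-suffix v rs with Levels.right-special-suffix N′ _ c (toList v) ≤-refl rs
  ... | k , s = k , subst (_≤ t̂ (suc k)) (Vec.length-toList v) (suffix-length s) , s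

  -- Both long words end in `Ŝ (suc j)`, preceded by a power of `Σ̂ j` in one and of `Σ̂ (suc j)` in
  -- the other. The letters just before `Ŝ (suc j)` differ by `last-letters`; `1≤N′`, that is N ≥ 2,
  -- makes the first power non-empty.
  branches-differ : ∀ j {u v} → IsSuffix u (T̂₊ j) → IsSuffix v (Ŝ (suc (suc j))) →
    ŝ (suc j) < length u → u ≢ v
  branches-differ j {u} s t s<u refl with last-letters N′ j d
  ... | a , Σ-a , Σ′-a = opposite-irrefl a (∷-injectiveˡ (suffix-same-length
    (suffix-comparable
      (branch a s (suffix-++ʳ (Ŝ (suc j)) (EndsIn-^ʷ 1≤N′ Σ-a)))
      (branch (opposite a) t (suffix-++ʳ (Ŝ (suc j)) (EndsIn-^ʷ (1≤d (suc j)) Σ′-a)))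
      ≤-refl) ≤-refl))
    where
    branch : ∀ {w} a → IsSuffix u w → IsSuffix (a ∷ Ŝ (suc j)) w → IsSuffix (a ∷ Ŝ (suc j)) u
    branch a s t = suffix-comparable t s s<u

  RightSpecialCount : ∀ n → ℕ → Set
  RightSpecialCount n r = Σ[ R ∈ List (Vec Letter n) ] ListsRightSpecial ω R × length R ≡ r

  lists-0 : RightSpecialCount 0 1
  lists-0 = Vec.[] ∷ [] , ([] ∷ [] ,
    (λ { Vec.[] → mk⇔ (λ _ → T̂-suffix-special 0 (T̂₊ 0 , ++-identityʳ (T̂₊ 0))) (λ _ → here refl) })) , refl

  -- The words `T̂₊ k` with `k < j` are too short, and all those with `k ≥ j` end in `Ŝ (suc j)`, so
  -- they share one suffix of length `n`.
  lists-case₁ : ∀ {n} → Case₁ n → RightSpecialCount n 1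
  lists-case₁ {n} (j , t<n , n≤s) = v ∷ [] , ([] ∷ [] , λ w → mk⇔ sound (complete w)) , refl
    where
    v = proj₁ (suffix-vec n≤s)
    v-suffix = proj₂ (suffix-vec n≤s)

    sound : ∀ {w} → w ∈ v ∷ [] → RightSpecial ω (toList w)
    sound (here refl) = T̂-suffix-special j (suffix-trans v-suffix (Ŝ-suffix-T̂ {j} ≤-refl))

    complete : ∀ w → RightSpecial ω (toList w) → w ∈ v ∷ []
    complete w rs with special-suffix w rs
    ... | k , n≤t , s with j ≤? k
    ...   | yes j≤k = here (suffix-vec-unique w v (suffix-of-suffix w n≤s s (Ŝ-suffix-T̂ j≤k)) v-suffix)
    ...   | no  j≰k = ⊥-elim (<⇒≱ t<n (≤-trans n≤t (t̂-mono (≰⇒> j≰k))))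

  -- Again `k < j` is too short. The word `T̂₊ j` supplies one suffix, and all `T̂₊ k` with `k > j`
  -- supply the same other one, through `Ŝ (suc (suc j))`.
  lists-case₂ : ∀ {n} → Case₂ n → RightSpecialCount n 2
  lists-case₂ {n} (j , s<n , n≤t) =
    u ∷ v ∷ [] , ((u≢v ∷ []) ∷ [] ∷ [] , λ w → mk⇔ sound (complete w)) , refl
    where
    n≤s : n ≤ ŝ (suc (suc j))
    n≤s = ≤-trans n≤t (<⇒≤ (t̂<ŝ (suc j)))

    u = proj₁ (suffix-vec n≤t)
    v = proj₁ (suffix-vec n≤s)
    u-suffix = proj₂ (suffix-vec n≤t)
    v-suffix = proj₂ (suffix-vec n≤s)

    u≢v : u ≢ v
    u≢v u≡v = branches-differ j u-suffix v-suffix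
      (subst (ŝ (suc j) <_) (sym (Vec.length-toList u)) s<n) (cong toList u≡v)

    sound : ∀ {w} → w ∈ u ∷ v ∷ [] → RightSpecial ω (toList w)
    sound (here refl)         = T̂-suffix-special j u-suffix
    sound (there (here refl)) =
      T̂-suffix-special (suc j) (suffix-trans v-suffix (Ŝ-suffix-T̂ {suc j} ≤-refl))

    complete : ∀ w → RightSpecial ω (toList w) → w ∈ u ∷ v ∷ []
    complete w rs with special-suffix w rs
    ... | k , n≤t′ , s with j ≤? k
    ...   | no  j≰k = ⊥-elim (<⇒≱ s<n (≤-trans n≤t′ (≤-trans (t̂-mono (≰⇒> j≰k)) (<⇒≤ (t̂<ŝ j)))))
    ...   | yes j≤k with m≤n⇒m<n∨m≡n j≤k
    ...     | inj₁ j<k  = there (here (suffix-vec-unique w v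
      (suffix-of-suffix w n≤s s (Ŝ-suffix-T̂ j<k)) v-suffix))
    ...     | inj₂ refl = here (suffix-vec-unique w u s u-suffix)

  right-specials : ∀ n → Σ[ R ∈ List (Vec Letter n) ] ListsRightSpecial ω R ×
    (1 ≤ n → (Case₁ n → length R ≡ 1) × (Case₂ n → length R ≡ 2))
  right-specials zero = let R , R-lists , _ = lists-0 in R , R-lists , λ ()
  right-specials n@(suc _) with cases n (s≤s z≤n)
  ... | inj₁ c₁ = let R , R-lists , eq = lists-case₁ c₁ in
    R , R-lists , λ _ → (λ _ → eq) , (λ c₂ → ⊥-elim (cases-exclusive c₁ c₂))
  ... | inj₂ c₂ = let R , R-lists , eq = lists-case₂ c₂ in
    R , R-lists , λ _ → (λ c₁ → ⊥-elim (cases-exclusive c₁ c₂)) , (λ _ → eq)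

-- Digits of N-continued fractions

fromℕ-mono-≤ : ∀ {m n} → m ≤ n → fromℕ m ℚ.≤ fromℕ n
fromℕ-mono-≤ m≤n = go (≤⇒≤′ m≤n)
  where
  go : ∀ {m n} → m ≤′ n → fromℕ m ℚ.≤ fromℕ n
  go ≤′-refl           = ℚ.≤-refl
  go (≤′-step {n} m≤n) = ℚ.≤-trans (go m≤n) (begin
    fromℕ n             ≡⟨ ℚ.+-identityˡ (fromℕ n) ⟨
    ℚ.0ℚ ℚ.+ fromℕ n    ≤⟨ ℚ.+-monoˡ-≤ (fromℕ n) (ℚ.<⇒≤ (ℚ.positive⁻¹ ℚ.1ℚ)) ⟩
    ℚ.1ℚ ℚ.+ fromℕ n    ≡⟨ fromℕ-suc n ⟨
    fromℕ (suc n)       ∎)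
    where open ℚ.≤-Reasoning

-- The upper bound d + 1 on N/x is witnessed by a rational r < x with N < (d + 1) r, and x ≤ 1
-- forces r ≤ 1, so N < d + 1.
floor≥N : ∀ N .{{_ : NonZero N}} x d → IsFloor (NCF.N/.quotient N x) d → N ≤ d
floor≥N N x d (_ , r , 0<r , l , N<[1+d]r) = ≮⇒≥ λ d<N → ℚ.<-irrefl refl (ℚ.<-≤-trans N<[1+d]r (begin
    fromℕ (suc d) ℚ.* r       ≤⟨ ℚ.*-monoˡ-≤-nonNeg (fromℕ (suc d)) {{nonNeg}} r≤1 ⟩
    fromℕ (suc d) ℚ.* ℚ.1ℚ    ≡⟨ ℚ.*-identityʳ (fromℕ (suc d)) ⟩
    fromℕ (suc d)             ≤⟨ fromℕ-mono-≤ d<N ⟩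
    fromℕ N                   ∎))
  where
  open ℚ.≤-Reasoning
  open UnitIrrational x
  nonNeg = ℚ.pos⇒nonNeg (fromℕ (suc d)) {{ℚ.positive (fromℕ-pos (suc d))}}
  r≤1 : r ℚ.≤ ℚ.1ℚ
  r≤1 = ℚ.≮⇒≥ λ 1<r → real≤1 (ℝ.lower-closed real 1<r l)

digit≥N : ∀ N .{{_ : NonZero N}} x n → N ≤ NCF.digit N x n
digit≥N N x n = floor≥N N (NCF.T^ N n x) (NCF.digit N x n) (proj₂ (NCF.⌊N/_⌋ N (NCF.T^ N n x)))

IsImage-cong : ∀ {g h μ ν} → g ≗ h → IsImage g μ ν → IsImage h μ ν
IsImage-cong {μ = μ} {ν} g≗h image m =
  subst (λ w → prefix ν (length w) ≡ w) (concatMap-cong g≗h (prefix μ m)) (image m)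

applyUpTo-cong : ∀ {A : Set} {f g : ℕ → A} → f ≗ g → ∀ n → applyUpTo f n ≡ applyUpTo g n
applyUpTo-cong f≗g zero    = refl
applyUpTo-cong f≗g (suc n) = cong₂ _∷_ (f≗g 0) (applyUpTo-cong (f≗g ∘ suc) n)

-- A dual sequence agrees with level 0 only pointwise; putting `ω` itself at level 0 makes the
-- results on `ωs 0` results on `ω` by computation.
replace-head : ∀ {A : Set} → A → (ℕ → A) → ℕ → A
replace-head a f zero    = a
replace-head a f (suc n) = f (suc n)

dual-chain : ∀ N′ d {ω} → (∀ n → suc N′ ≤ d n) → (dual : Dual.IsDualSequence (suc N′) d ω) →
  Levels.Chain N′ d (replace-head ω (proj₁ dual))
dual-chain N′ d {ω} N≤d (ωs , ωs₀ , images) =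
  record { digits = N≤d ; images = λ n → IsImage-cong (Levels.σ̂≗σ N′ d n) (images′ n) }
  where
  images′ : ∀ n → IsImage (Dual.σ̂ (suc N′) d n) (ωs (suc n)) (replace-head ω ωs n)
  images′ zero    m = trans (sym (applyUpTo-cong ωs₀ _)) (images 0 m)
  images′ (suc n) m = images (suc n) m

-- First differences of the complexity

+-⊖ : ∀ m n → (m + n) ⊖ m ≡ + n
+-⊖ m n = trans (ℤ.⊖-≥ (m≤m+n m n)) (cong +_ (m+n∸m≡n m n))

-- Stated for arbitrary digits bounded below by `N`; continued fractions enter through `digit≥N`
-- alone.
dual-complexity : ∀ N → 2 ≤ N → (d : ℕ → ℕ) → (∀ n → N ≤ d n) → let open Dual N d in
  ∀ ω → IsDualSequence ω →
  ∃[ p ] IsFactorComplexity ω p ×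
  (∀ n → 1 ≤ n →
    (Case₁ n ⊎ Case₂ n) ×
    (Case₁ n → p (n + 1) ⊖ p n ≡ + 1) ×
    (Case₂ n → p (n + 1) ⊖ p n ≡ + 2))
dual-complexity (suc N′) (s≤s 1≤N′) d N≤d ω dual =
  p , complexity , λ n 1≤n → cases n 1≤n ,
    (λ c₁ → increment n (proj₁ (counts n 1≤n) c₁)) ,
    (λ c₂ → increment n (proj₂ (counts n 1≤n) c₂))
  where
  open Lengths N′ d N≤d using (cases)
  open RightSpecials N′ 1≤N′ (dual-chain N′ d N≤d dual) using (right-specials)

  counts = λ n → proj₂ (proj₂ (right-specials n))
  result = complexity-from-right-special ω (proj₁ ∘ right-specials) (proj₁ ∘ proj₂ ∘ right-specials)
  p = proj₁ result
  complexity = proj₁ (proj₂ result)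

  increment : ∀ n {r} → length (proj₁ (right-specials n)) ≡ r → p (n + 1) ⊖ p n ≡ + r
  increment n refl = trans (cong (λ m → p m ⊖ p n) (+-comm n 1))
    (trans (cong (_⊖ p n) (proj₂ (proj₂ result) n)) (+-⊖ (p n) _))

lemma5p12 : (N : ℕ) .{{_ : NonZero N}} → 2 ≤ N →
    (x : UnitIrrational) → let open Dual N (NCF.digit N x) in
    (ω : InfWord) → IsDualSequence ω →
    ∃[ p ] IsFactorComplexity ω p ×
    (∀ n → 1 ≤ n →
    (Case₁ n ⊎ Case₂ n) ×
    (Case₁ n → p (n + 1) ⊖ p n ≡ + 1) ×
    (Case₂ n → p (n + 1) ⊖ p n ≡ + 2))
lemma5p12 N 2≤N x = dual-complexity N 2≤N (NCF.digit N x) (digit≥N N x)
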